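{- Let $G=(V,E)$ be a graph with edge coloring $\mathcal{C}:E\to C$ and let $S\subseteq V$ be a set of terminals. Suppose that $G$ has no alternating trail connecting distinct terminals. Let $(I,\pi,F)$ be a maximal colored blossom forest (with respect to the partial order $<$ on colored blossom forests). Let $A$ be the set of inner vertices of $G$ with respect to $(I,\pi,F)$, and for each $c\in C$ define \[A(c)=\{u\in A:\text{the predecessor edge of }[u]\text{ in }F\text{ has color }c\}.\] Then $A$ is a Tutte set with coloring given by $A=\dot\bigcup_{c\in C}A(c)$.
   Context: Graphs are finite and undirected; parallel edges are allowed, loops are not. Colors come from a set $C$ with $\#C\ge 2$. A $v_0$-$v_m$ walk is a sequence $W=(v_0,e_1,v_1,\ldots,e_m,v_m)$, $m\ge 0$, where each $e_j\in E$ has endpoints $v_{j-1},v_j$. Its length is $m$, its first edge is $e_1$ and its last edge is $e_m$. It is a trail when its edges are distinct; closed when $v_0=v_m$; internally alternating when $\mathcal{C}(e_j)\ne\mathcal{C}(e_{j+1})$ for $j=1,\ldots,m-1$; alternating when in addition, if $W$ is closed, $\mathcal{C}(e_m)\ne\mathcal{C}(e_1)$. A trail connects distinct terminals if it is an $s$-$t$ trail with $s,t\in S$, $s\ne t$. Tutte set: $A\subseteq V-S$ is a Tutte set with coloring $A=\dot\bigcup_{c\in C}A(c)$ (disjoint union, empty blocks allowed; $u\in A(c)$ is said to have color $c$) when (i) each component of $G-A$ contains at most one terminal; and (ii): (a) if a component $H$ of $G-A$ contains a terminal, no mismatched edge has an endpoint in $H$; (b) if a component $H$ of $G-A$ contains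 no terminal, at most one mismatched edge has an endpoint in $H$; (c) no mismatched edge has both endpoints in $A$. Here an edge $e$ is mismatched if either it connects $u\in A$ with $v\in V-A$ and $\mathcal{C}(e)$ differs from the color of $u$, or it connects $u,v\in A$ and $\mathcal{C}(e)$ differs from both the colors of $u$ and of $v$. Blossoms: a subgraph $G'=(V',E')$ of $G$ is a blossom with base $u$ when $u\in V'$ and for each $v\in V'$, $v\ne u$, $G'$ has two alternating $v$-$u$ trails whose first edges have different colors. For $c\in C$, $G'$ is a $c$-blossom with base $u$ when (i) $u\in V'$; (ii) for each $v\in V'$, $v\neq u$, $G'$ has two alternating $v$-$u$ trails whose first edges have different colors and whose last edges have colors different from $c$; (iii) $G'$ has an internally alternating $u$-$u$ trail of positive length whose first and last edges have colors different from $c$. For a partition $\pi$ of the vertex set of a graph $K$, $K\times\pi$ is the graph whose vertices are the blocks of $\pi$ and whose edges are the edges of $K$ joining different blocks (with those blocks as endpoints). $[v]$ is the block of $\pi$ containing $v$; $G[U]$ is the subgraph induced on $U$. In a rooted forest, the predecessor edge of a non-root vertex $x$ is the first edge of the unique path from $x$ to the root of its component. A colored blossom forest is a triple $(I,\pi,F)$ with $S\subseteq I\subseteq V$, $\pi$ a partition of $I$, and $F$ a rooted forest in $G[I]\times\pi$ (whose vertices are all the blocks of $\pi$) such that: (i) $F$ has $\#S$ components and its roots are $[s]$, $s\in S$; (ii) for each $s\in S$, $G[[s]]$ is a blossom with base $s$; (iii) if $[v]$ is a non-root vertex of $F$ with $\#[v]=1$, with predecessor edge $e$, then all edges of $F$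 between $[v]$ and its children have colors different from $\mathcal{C}(e)$; (iv) if $[v]$ is a non-root vertex of $F$ with $\#[v]\ge2$, its predecessor edge has color $c$, and $u\in[v]$ is the endpoint (in $G$) of that edge contained in $[v]$, then $G[[v]]$ is a $c$-blossom with base $u$. A vertex $v\in I$ is an inner vertex if $\#[v]=1$ and $[v]$ is a non-root vertex of $F$. Partial order: $(I,\pi,F)<(I',\pi',F')$ if $I\subsetneq I'$, or $I=I'$ and $\pi<\pi'$ (every block of $\pi$ is contained in a block of $\pi'$ and $\pi\ne\pi'$). -}

module Defs where

open import Data.Nat using (ℕ; _≥_; _>_)
open import Data.Fin using (Fin)
open import Data.Fin.Subset using (Subset; _∈_; _∉_; _⊆_; _⊂_; ∣_∣; Nonempty)
open import Data.List using (List; []; _∷_; length; head; last)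
open import Data.List.Relation.Unary.Linked using (Linked)
open import Data.List.Relation.Unary.Unique.Propositional using (Unique)
open import Data.Maybe using (just)
open import Data.Product using (Σ; Σ-syntax; ∃; ∃-syntax; ∃₂; _×_; _,_; proj₁; proj₂)
open import Data.Sum using (_⊎_)
open import Function using (_⇔_)
open import Relation.Binary.PropositionalEquality using (_≡_; _≢_)
open import Relation.Nullary using (¬_)
open import Relation.Unary using (Pred)
open import Level using (0ℓ)

-- The two orderings of the pair  ends e  describe the same undirected
-- edge, and different edges may have the same ends; see  Joins.
record Graph : Set where
  field
    order size : ℕ
    ends       : Fin size → Fin order × Fin order
    loopless   : ∀ e → proj₁ (ends e) ≢ proj₂ (ends e)

  Vertex Edge : Set
  Vertex = Fin order
  Edge   = Fin size

-- J e x y : the edge e has endpoints x and y.  Walks are defined over an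
-- arbitrary incidence relation, so that they can be used alike in G, in
-- its subgraphs and in graphs whose vertices are the blocks of a partition.
Incidence : Set → Set → Set₁
Incidence V E = E → V → V → Set

data Walk {V E : Set} (J : Incidence V E) : V → V → Set where
  stay : ∀ {x} → Walk J x x
  step : ∀ {x y z} (e : E) → J e x y → Walk J y z → Walk J x z

module _ {V E : Set} {J : Incidence V E} where

  edges : ∀ {x y} → Walk J x y → List E
  edges stay         = []
  edges (step e _ w) = e ∷ edges w

  -- The vertices v₁, …, vₘ of the walk (v₀, e₁, v₁, …, eₘ, vₘ).
  laterVertices : ∀ {x y} → Walk J x y → List V
  laterVertices stay                 = []
  laterVertices (step {y = y} _ _ w) = y ∷ laterVertices w

  IsTrail : ∀ {x y} → Walk J x y → Set
  IsTrail w = Unique (edges w)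

  IsPath : ∀ {x y} → Walk J x y → Set
  IsPath {x} w = Unique (x ∷ laterVertices w)

  -- Parallel edges form a cycle of length 2.
  IsCycle : ∀ {x} → Walk J x x → Set
  IsCycle w = length (edges w) > 0 × IsTrail w × Unique (laterVertices w)

  FirstEdge LastEdge : ∀ {x y} → Walk J x y → E → Set
  FirstEdge w e = head (edges w) ≡ just e
  LastEdge  w e = last (edges w) ≡ just e

  module _ {C : Set} (col : E → C) where

    IsInternallyAlternating : ∀ {x y} → Walk J x y → Set
    IsInternallyAlternating w = Linked (λ e f → col e ≢ col f) (edges w)

    IsAlternating : ∀ {x y} → Walk J x y → Set
    IsAlternating {x} {y} w =
      IsInternallyAlternating w ×
      (x ≡ y → ∀ {e f} → FirstEdge w e → LastEdge w f → col f ≢ col e)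

Connected : {V E : Set} → Incidence V E → V → V → Set
Connected J x y = Walk J x y

Acyclic : {V E : Set} → Incidence V E → Set
Acyclic {V} J = {x : V} (w : Walk J x x) → ¬ IsCycle w

-- The graph with vertex set V has exactly k components: there is a system
-- of k representatives, one in each component.
HasComponents : {V E : Set} → Incidence V E → ℕ → Set
HasComponents {V} J k =
  Σ[ r ∈ (Fin k → V) ]
    (∀ i j → Connected J (r i) (r j) → i ≡ j) ×
    (∀ x → ∃[ i ] Connected J x (r i))

module _ (G : Graph) where
  open Graph G

  Joins : Incidence Vertex Edge
  Joins e u v = ends e ≡ (u , v) ⊎ ends e ≡ (v , u)

  record Subgraph : Set₁ where
    field
      vertices   : Pred Vertex 0ℓ
      edgeSet    : Pred Edge 0ℓ
      endsInside : ∀ e → edgeSet e →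
                   vertices (proj₁ (ends e)) × vertices (proj₂ (ends e))

  induced : Pred Vertex 0ℓ → Subgraph
  induced U = record
    { vertices   = U
    ; edgeSet    = λ e → U (proj₁ (ends e)) × U (proj₂ (ends e))
    ; endsInside = λ _ inside → inside
    }

JoinsIn : {G : Graph} → Subgraph G → Incidence (Graph.Vertex G) (Graph.Edge G)
JoinsIn {G} H e u v = Subgraph.edgeSet H e × Joins G e u v

-- The blocks are listed without repetition (by disjointness and
-- nonemptiness).  The order in which they are listed is immaterial:
-- partitions are compared by _≈π_ below.
record Partition {n : ℕ} (I : Subset n) : Set where
  field
    #blocks  : ℕ
    block    : Fin #blocks → Subset n
    nonempty : ∀ i → Nonempty (block i)
    disjoint : ∀ {i j v} → v ∈ block i → v ∈ block j → i ≡ j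
    union    : ∀ v → v ∈ I ⇔ (∃[ i ] v ∈ block i)

-- The partitioned sets I and I′ are allowed to differ only so that no
-- transport is needed when they are merely propositionally equal.
module _ {n : ℕ} {I I′ : Subset n} (π : Partition I) (π′ : Partition I′) where
  private
    module π  = Partition π
    module π′ = Partition π′

  _≤π_ : Set
  _≤π_ = ∀ i → ∃[ j ] π.block i ⊆ π′.block j

  _≈π_ : Set
  _≈π_ = (∀ i → ∃[ j ] π.block i ≡ π′.block j) ×
         (∀ j → ∃[ i ] π.block i ≡ π′.block j)

  _<π_ : Set
  _<π_ = _≤π_ × ¬ _≈π_

-- G[I] × π, with the block  block i  represented by its index i.
quotient : (G : Graph) {I : Subset (Graph.order G)} (π : Partition I) →
           Incidence (Fin (Partition.#blocks π)) (Graph.Edge G)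
quotient G {I} π e i j =
  i ≢ j × ∃₂ λ u v → u ∈ block i × v ∈ block j × JoinsIn (induced G (_∈ I)) e u v
  where open Partition π

-- A spanning rooted forest of the graph with vertex set Fin k, edges among
-- Fin m, and incidence J.
record RootedForest {k m : ℕ} (J : Incidence (Fin k) (Fin m)) : Set where
  field
    edgeSet : Subset m
    isEdge  : ∀ {e} → e ∈ edgeSet → ∃₂ λ x y → J e x y
    roots   : Subset k

  JoinsF : Incidence (Fin k) (Fin m)
  JoinsF e x y = e ∈ edgeSet × J e x y

  field
    acyclic    : Acyclic JoinsF
    hasRoot    : ∀ x → ∃[ r ] r ∈ roots × Connected JoinsF x r
    uniqueRoot : ∀ {r r′} → r ∈ roots → r′ ∈ roots → Connected JoinsF r r′ → r ≡ r′

  -- The path from x to the root of its component starts with the edge e,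
  -- which leads to y.
  Predecessor : Fin k → Fin m → Fin k → Set
  Predecessor x e y =
    ∃[ r ] r ∈ roots × Σ[ j ∈ JoinsF e x y ] Σ[ w ∈ Walk JoinsF y r ] IsPath (step e j w)

  PredecessorEdge : Fin k → Fin m → Set
  PredecessorEdge x e = ∃[ y ] Predecessor x e y

  Child : Fin k → Fin k → Set
  Child x y = ∃[ e ] Predecessor y e x

module _ (G : Graph) {C : Set} (col : Graph.Edge G → C) where
  open Graph G

  record IsBlossom (H : Subgraph G) (u : Vertex) : Set where
    field
      base   : Subgraph.vertices H u
      trails : ∀ v → Subgraph.vertices H v → v ≢ u →
               Σ[ w ∈ Walk (JoinsIn H) v u ] Σ[ w′ ∈ Walk (JoinsIn H) v u ]
                 (IsTrail w × IsAlternating col w) ×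
                 (IsTrail w′ × IsAlternating col w′) ×
                 (∃₂ λ e e′ → FirstEdge w e × FirstEdge w′ e′ × col e ≢ col e′)

  record IsColorBlossom (c : C) (H : Subgraph G) (u : Vertex) : Set where
    field
      base        : Subgraph.vertices H u
      trails      : ∀ v → Subgraph.vertices H v → v ≢ u →
                    Σ[ w ∈ Walk (JoinsIn H) v u ] Σ[ w′ ∈ Walk (JoinsIn H) v u ]
                      (IsTrail w × IsAlternating col w) ×
                      (IsTrail w′ × IsAlternating col w′) ×
                      (∃₂ λ e e′ → FirstEdge w e × FirstEdge w′ e′ × col e ≢ col e′) ×
                      (∃₂ λ f f′ → LastEdge w f × LastEdge w′ f′ × col f ≢ c × col f′ ≢ c)
      closedTrail : Σ[ w ∈ Walk (JoinsIn H) u u ]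
                      length (edges w) > 0 × IsTrail w × IsInternallyAlternating col w ×
                      (∃₂ λ e f → FirstEdge w e × LastEdge w f × col e ≢ c × col f ≢ c)

  module _ (S : Subset order) where

    HasConnectingTrail : Set
    HasConnectingTrail =
      ∃₂ λ s t → s ∈ S × t ∈ S × s ≢ t ×
        (Σ[ w ∈ Walk (Joins G) s t ] IsTrail w × IsAlternating col w)

    record ColoredBlossomForest : Set where
      field
        I   : Subset order
        S⊆I : S ⊆ I
        π   : Partition I
        F   : RootedForest (quotient G π)

      open Partition π public
      open RootedForest F public

      field
        components : HasComponents JoinsF ∣ S ∣
        rootBlocks : ∀ i → i ∈ roots ⇔ (∃[ s ] s ∈ S × s ∈ block i)
        rootBlossom : ∀ {s i} → s ∈ S → s ∈ block i →
                      IsBlossom (induced G (_∈ block i)) s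
        innerAlternates : ∀ {i e} → i ∉ roots → ∣ block i ∣ ≡ 1 → PredecessorEdge i e →
                          ∀ {j f} → Child i j → JoinsF f i j → col f ≢ col e
        nonRootBlossom : ∀ {i e u} → i ∉ roots → ∣ block i ∣ ≥ 2 → PredecessorEdge i e →
                         u ∈ block i → (∃[ v ] Joins G e u v) →
                         IsColorBlossom (col e) (induced G (_∈ block i)) u

      IsInner : Pred Vertex 0ℓ
      IsInner v = ∃[ i ] v ∈ block i × ∣ block i ∣ ≡ 1 × i ∉ roots

      IsInnerOfColor : C → Pred Vertex 0ℓ
      IsInnerOfColor c u =
        IsInner u × (∃₂ λ i e → u ∈ block i × PredecessorEdge i e × col e ≡ c)

    _<F_ : ColoredBlossomForest → ColoredBlossomForest → Set
    X <F Y = X.I ⊂ Y.I ⊎ (X.I ≡ Y.I × X.π <π Y.π)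
      where
      module X = ColoredBlossomForest X
      module Y = ColoredBlossomForest Y

    IsMaximal : ColoredBlossomForest → Set
    IsMaximal X = ∀ Y → ¬ (X <F Y)

    module _ (A : Pred Vertex 0ℓ) (A[_] : C → Pred Vertex 0ℓ) where

      Mismatched : Edge → Set
      Mismatched e =
        (∃₂ λ u v → ∃[ c ] Joins G e u v × A u × ¬ A v × A[ c ] u × col e ≢ c) ⊎
        (∃₂ λ u v → ∃₂ λ c d → Joins G e u v × A u × A v × A[ c ] u × A[ d ] v ×
                                col e ≢ c × col e ≢ d)

      -- The vertex set of the component of G - A that contains h, for h ∉ A.
      Component : Vertex → Pred Vertex 0ℓ
      Component h = Connected (JoinsIn (induced G (λ v → ¬ A v))) h

      HasEndpointIn : Pred Vertex 0ℓ → Edge → Set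
      HasEndpointIn H e = ∃₂ λ u v → Joins G e u v × H u

      record IsTutteSet : Set where
        field
          avoidsTerminals : ∀ {v} → A v → v ∉ S
          colorUnion      : ∀ v → A v ⇔ (∃[ c ] A[ c ] v)
          colorDisjoint   : ∀ {c d v} → A[ c ] v → A[ d ] v → c ≡ d
          oneTerminal     : ∀ h → ¬ A h → ∀ {s t} → s ∈ S → t ∈ S →
                            Component h s → Component h t → s ≡ t
          terminalComp    : ∀ h → ¬ A h → (∃[ s ] s ∈ S × Component h s) →
                            ∀ e → Mismatched e → ¬ HasEndpointIn (Component h) e
          terminalFreeComp : ∀ h → ¬ A h → ¬ (∃[ s ] s ∈ S × Component h s) →
                             ∀ {e f} → Mismatched e → Mismatched f →
                             HasEndpointIn (Component h) e → HasEndpointIn (Component h) f →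
                             e ≡ f
          insideA         : ∀ {e u v} → Mismatched e → Joins G e u v → ¬ (A u × A v)

module Submission where

-- In each block of a colored blossom forest other than an inner vertex, a
-- walk arriving by any edge can be continued to the base and out along the
-- predecessor edge; at an inner vertex this works exactly when the arriving
-- edge does not have the color of the predecessor edge.  Call the edge good
-- at its endpoint in these cases.  From an endpoint where e is good there is
-- then an alternating trail up to a terminal, to be preceded by e.
--
-- A mismatched edge is good at each of its ends covered by the forest, and
-- so is every edge between blocks that are not inner vertices.  Let e be
-- good at its end x.  If its other end y is not covered, adding y as an inner
-- vertex gives a larger forest.  If e is good at both ends, and these lie in
-- different trees, the two trails upwards and e form an alternating trail
-- connecting distinct terminals.  If they lie in the same tree and e is not
-- in the forest, the blocks on the fundamental cycle of e can be contracted: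
-- every arrival in their union can be continued to its base, an inner vertex
-- v entered by an edge of the color of its predecessor edge being left
-- downwards, around the cycle.  A forest edge between two blocks that are
-- not inner vertices can be contracted likewise.  By maximality, the only
-- edges good at both ends are therefore the predecessor edges of blocks that
-- are not inner and whose parent is inner, which is what the conditions on a
-- Tutte set require.

open import Defs
open import Data.Bool using (true)
open import Data.Empty using (⊥-elim)
open import Data.Fin using (Fin; zero; suc)
open import Data.Fin.Properties using (_≟_; suc-injective; any?)
open import Data.Fin.Subset using (Subset; inside; outside; _∈_; _∉_; _⊆_; ∣_∣)
open import Data.Fin.Subset.Properties using (_∈?_; ⊆-antisym)
open import Data.List using (List; []; _∷_; _++_; length; head; last; reverse)
open import Data.List.Membership.Propositional using () renaming (_∈_ to _∈ˡ_; _∉_ to _∉ˡ_)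
open import Data.List.Membership.Propositional.Properties using (∈-++⁻)
open import Data.List.Properties using (++-assoc; ++-identityʳ; unfold-reverse; reverse-++)
open import Data.List.Relation.Unary.All as All using (All; []; _∷_)
open import Data.List.Relation.Unary.All.Properties using (¬Any⇒All¬; All¬⇒¬Any)
open import Data.List.Relation.Unary.AllPairs using ([]; _∷_)
open import Data.List.Relation.Unary.Any as Any using (here; there)
open import Data.List.Relation.Unary.Linked as Linked using (Linked; []; [-]; _∷_; _∷′_)
import Data.List.Relation.Unary.Linked.Properties as Linkedₚ
open import Data.List.Relation.Unary.Unique.Propositional using (Unique)
import Data.List.Relation.Unary.Unique.Propositional.Properties as Uniqueₚ
open import Data.Maybe as Maybe using (Maybe; just; nothing)
open import Data.Maybe.Properties using (just-injective; ≡-dec)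
import Data.Maybe.Relation.Binary.Connected as Conn
open import Data.Nat using (ℕ; zero; suc; _≤_; _<_; _≥_; z≤n; s≤s)
import Data.Nat.Properties as ℕ
open import Data.Nat.Induction using (<-wellFounded)
open import Data.Product using (Σ-syntax; ∃; ∃-syntax; ∃₂; _×_; _,_; proj₁; proj₂)
open import Data.Product.Properties using (,-injective)
open import Data.Sum using (_⊎_; inj₁; inj₂; [_,_]′; swap)
open import Data.Unit using (⊤)
open import Data.Vec as Vec using (tabulate; []; _∷_)
open import Data.Vec.Properties using (lookup∘tabulate; []=⇒lookup; lookup⇒[]=)
open import Function using (_∘_; id; mk⇔; Equivalence)
open import Induction.WellFounded using (Acc; acc)
open import Relation.Binary.PropositionalEquality
  using (_≡_; _≢_; refl; sym; trans; cong; cong₂; subst; subst₂; module ≡-Reasoning)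
open import Relation.Nullary using (¬_; Dec; yes; no; does; contradiction)
open import Relation.Nullary.Decidable
  using (decidable-stable; ¬¬-excluded-middle; _×-dec_; _⊎-dec_; map′)
open import Level using (0ℓ)
open import Relation.Unary using (Pred)

-- Lists: linked neighbours, repetitions and reversal.

module _ {A : Set} {R : A → A → Set} where

  -- The shared entry `p` carries the relation on both sides, so nothing is left to compare at the
  -- seam.
  linked-join : ∀ xs {p ys} → Linked R (xs ++ p ∷ []) → Linked R (p ∷ ys) →
                Linked R (xs ++ p ∷ ys)
  linked-join []           _        l = l
  linked-join (x ∷ [])     (r ∷ _)  l = r ∷ l
  linked-join (x ∷ y ∷ xs) (r ∷ l′) l = r ∷ linked-join (y ∷ xs) l′ l

  linked-cons : ∀ {x y xs} → head xs ≡ just y → R x y → Linked R xs → Linked R (x ∷ xs)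
  linked-cons h r l = subst (Conn.Connected R _) (sym h) (Conn.just r) ∷′ l

  linked-snoc : ∀ {xs y z} → last xs ≡ just y → R y z → Linked R xs → Linked R (xs ++ z ∷ [])
  linked-snoc h r l =
    Linkedₚ.++⁺ l (subst (λ m → Conn.Connected R m _) (sym h) (Conn.just r)) [-]

  linked-last : ∀ xs {y z} → last xs ≡ just y → Linked R (xs ++ z ∷ []) → R y z
  linked-last (_ ∷ [])     refl (r ∷ _) = r
  linked-last (_ ∷ y ∷ xs) h    (_ ∷ l) = linked-last (y ∷ xs) h l

  linked-++⁻ˡ : ∀ xs {ys} → Linked R (xs ++ ys) → Linked R xs
  linked-++⁻ˡ []           _       = []
  linked-++⁻ˡ (x ∷ [])     _       = [-]
  linked-++⁻ˡ (x ∷ y ∷ xs) (r ∷ l) = r ∷ linked-++⁻ˡ (y ∷ xs) l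

  linked-reverse : (∀ {x y} → R x y → R y x) → ∀ {xs} → Linked R xs → Linked R (reverse xs)
  linked-reverse R-sym []  = []
  linked-reverse R-sym [-] = [-]
  linked-reverse R-sym {x ∷ y ∷ zs} (r ∷ l) = subst (Linked R) eq
    (linked-join (reverse zs) (subst (Linked R) (unfold-reverse y zs) (linked-reverse R-sym l))
      (R-sym r ∷ [-]))
    where
    eq : reverse zs ++ y ∷ x ∷ [] ≡ reverse (x ∷ y ∷ zs)
    eq = sym (reverse-++ (x ∷ y ∷ []) zs)

unique-snoc : {A : Set} {xs : List A} {x : A} → Unique xs → x ∉ˡ xs → Unique (xs ++ x ∷ [])
unique-snoc u x∉ = Uniqueₚ.++⁺ u ([] ∷ []) λ { (y∈ , here refl) → x∉ y∈ }

unique-cons : {A : Set} {xs : List A} {x : A} → x ∉ˡ xs → Unique xs → Unique (x ∷ xs)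
unique-cons x∉ u = ¬Any⇒All¬ _ x∉ ∷ u

∈-reverse⁻ : {A : Set} {x : A} (xs : List A) → x ∈ˡ reverse xs → x ∈ˡ xs
∈-reverse⁻ (y ∷ xs) x∈ with ∈-++⁻ (reverse xs) (subst (_ ∈ˡ_) (unfold-reverse y xs) x∈)
... | inj₁ x∈ʳ         = there (∈-reverse⁻ xs x∈ʳ)
... | inj₂ (here refl) = here refl

unique-reverse : {A : Set} {xs : List A} → Unique xs → Unique (reverse xs)
unique-reverse {xs = []}     _         = []
unique-reverse {xs = x ∷ xs} (x∉ ∷ u) = subst Unique (sym (unfold-reverse x xs))
  (unique-snoc (unique-reverse u) (All¬⇒¬Any x∉ ∘ ∈-reverse⁻ xs))

head-++ : {A : Set} {xs ys : List A} {x : A} → head xs ≡ just x → head (xs ++ ys) ≡ just x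
head-++ {xs = _ ∷ _} eq = eq

last-∷ : {A : Set} (x : A) (xs : List A) → ∃[ y ] last (x ∷ xs) ≡ just y
last-∷ x []       = x , refl
last-∷ x (y ∷ xs) = last-∷ y xs

-- Finite subsets: comprehension, enumeration and cardinality.

module _ {n : ℕ} {P : Fin n → Set} (P? : ∀ v → Dec (P v)) where

  comprehension : Subset n
  comprehension = tabulate (does ∘ P?)

  ∈-comprehension⁺ : ∀ {v} → P v → v ∈ comprehension
  ∈-comprehension⁺ {v} p = lookup⇒[]= v _ (trans (lookup∘tabulate (does ∘ P?) v) (lemma (P? v)))
    where
    lemma : (d : Dec (P v)) → does d ≡ true
    lemma (yes _) = refl
    lemma (no ¬p) = contradiction p ¬p

  ∈-comprehension⁻ : ∀ {v} → v ∈ comprehension → P v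
  ∈-comprehension⁻ {v} v∈ =
    lemma (P? v) (trans (sym (lookup∘tabulate (does ∘ P?) v)) ([]=⇒lookup v∈))
    where
    lemma : (d : Dec (P v)) → does d ≡ true → P v
    lemma (yes p) _ = p

enumerate : ∀ {n} (p : Subset n) → Fin ∣ p ∣ → Fin n
enumerate (inside  ∷ p) zero    = zero
enumerate (inside  ∷ p) (suc i) = suc (enumerate p i)
enumerate (outside ∷ p) i       = suc (enumerate p i)

enumerate-∈ : ∀ {n} (p : Subset n) i → enumerate p i ∈ p
enumerate-∈ (inside  ∷ p) zero    = Vec.here
enumerate-∈ (inside  ∷ p) (suc i) = Vec.there (enumerate-∈ p i)
enumerate-∈ (outside ∷ p) i       = Vec.there (enumerate-∈ p i)

enumerate-injective : ∀ {n} (p : Subset n) {i j} → enumerate p i ≡ enumerate p j → i ≡ j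
enumerate-injective (inside  ∷ p) {zero}  {zero}  _  = refl
enumerate-injective (inside  ∷ p) {suc i} {suc j} eq =
  cong suc (enumerate-injective p (suc-injective eq))
enumerate-injective (outside ∷ p) eq = enumerate-injective p (suc-injective eq)

enumerate-surjective : ∀ {n} (p : Subset n) {v} → v ∈ p → ∃[ i ] enumerate p i ≡ v
enumerate-surjective (inside ∷ p) Vec.here = zero , refl
enumerate-surjective (inside ∷ p) (Vec.there v∈) with enumerate-surjective p v∈
... | i , eq = suc i , cong suc eq
enumerate-surjective (outside ∷ p) (Vec.there v∈) with enumerate-surjective p v∈
... | i , eq = i , cong suc eq

singleton-unique : ∀ {n} {p : Subset n} {u v} → ∣ p ∣ ≡ 1 → u ∈ p → v ∈ p → u ≡ v
singleton-unique {p = p} one u∈ v∈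
  with enumerate-surjective p u∈ | enumerate-surjective p v∈
... | i , refl | j , refl = cong (enumerate p) (all-equal one i j)
  where
  all-equal : ∀ {k} → k ≡ 1 → (i j : Fin k) → i ≡ j
  all-equal refl zero zero = refl

nonempty⇒∣∣≥1 : ∀ {n} {p : Subset n} {v} → v ∈ p → ∣ p ∣ ≥ 1
nonempty⇒∣∣≥1 {p = p} v∈ = lemma (proj₁ (enumerate-surjective p v∈))
  where
  lemma : ∀ {k} → Fin k → k ≥ 1
  lemma {suc _} _ = s≤s z≤n

unique⇒∣∣≤1 : ∀ {n} (p : Subset n) → (∀ {u v} → u ∈ p → v ∈ p → u ≡ v) → ∣ p ∣ ≤ 1
unique⇒∣∣≤1 p all-equal = lemma _ λ i j →
  enumerate-injective p (all-equal (enumerate-∈ p i) (enumerate-∈ p j))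
  where
  lemma : ∀ k → ((i j : Fin k) → i ≡ j) → k ≤ 1
  lemma 0             _  = z≤n
  lemma 1             _  = s≤s z≤n
  lemma (suc (suc k)) eq with () ← eq zero (suc zero)

-- Walks

module _ {V E : Set} {J : Incidence V E} where

  infixr 5 _⌢_

  _⌢_ : ∀ {x y z} → Walk J x y → Walk J y z → Walk J x z
  stay       ⌢ v = v
  step e j w ⌢ v = step e j (w ⌢ v)

  edges-⌢ : ∀ {x y z} (w : Walk J x y) (v : Walk J y z) → edges (w ⌢ v) ≡ edges w ++ edges v
  edges-⌢ stay         v = refl
  edges-⌢ (step e _ w) v = cong (e ∷_) (edges-⌢ w v)

  laterVertices-⌢ : ∀ {x y z} (w : Walk J x y) (v : Walk J y z) →
                    laterVertices (w ⌢ v) ≡ laterVertices w ++ laterVertices v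
  laterVertices-⌢ stay         v = refl
  laterVertices-⌢ (step _ _ w) v = cong (_ ∷_) (laterVertices-⌢ w v)

  module _ (J-sym : ∀ {e x y} → J e x y → J e y x) where

    reverseWalk : ∀ {x y} → Walk J x y → Walk J y x
    reverseWalk stay         = stay
    reverseWalk (step e j w) = reverseWalk w ⌢ step e (J-sym j) stay

    edges-reverse : ∀ {x y} (w : Walk J x y) → edges (reverseWalk w) ≡ reverse (edges w)
    edges-reverse stay         = refl
    edges-reverse (step e j w) = begin
      edges (reverseWalk w ⌢ step e (J-sym j) stay) ≡⟨ edges-⌢ (reverseWalk w) _ ⟩
      edges (reverseWalk w) ++ e ∷ []               ≡⟨ cong (_++ e ∷ []) (edges-reverse w) ⟩
      reverse (edges w) ++ e ∷ []                   ≡⟨ unfold-reverse e (edges w) ⟨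
      reverse (e ∷ edges w)                         ∎
      where open ≡-Reasoning

  edges-satisfy : ∀ {R : E → Set} → (∀ {e x y} → J e x y → R e) →
                  ∀ {x y} (w : Walk J x y) {e} → e ∈ˡ edges w → R e
  edges-satisfy f (step e j w) (here refl) = f j
  edges-satisfy f (step e j w) (there e∈)  = edges-satisfy f w e∈

module _ {V E : Set} {J J′ : Incidence V E} (f : ∀ {e x y} → J e x y → J′ e x y) where

  mapWalk : ∀ {x y} → Walk J x y → Walk J′ x y
  mapWalk stay         = stay
  mapWalk (step e j w) = step e (f j) (mapWalk w)

  edges-mapWalk : ∀ {x y} (w : Walk J x y) → edges (mapWalk w) ≡ edges w
  edges-mapWalk stay         = refl
  edges-mapWalk (step e _ w) = cong (e ∷_) (edges-mapWalk w)

  laterVertices-mapWalk : ∀ {x y} (w : Walk J x y) → laterVertices (mapWalk w) ≡ laterVertices w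
  laterVertices-mapWalk stay         = refl
  laterVertices-mapWalk (step _ _ w) = cong (_ ∷_) (laterVertices-mapWalk w)

-- Paths and forests

module _ {V E : Set} {J : Incidence V E} where

  IsPath-tail : ∀ {e x y z} {j : J e x y} (w : Walk J y z) → IsPath (step e j w) → IsPath w
  IsPath-tail w (_ ∷ u) = u

  suffixFrom : ∀ {x y a} (w : Walk J x y) → a ∈ˡ x ∷ laterVertices w →
               Σ[ w′ ∈ Walk J a y ] (IsPath w → IsPath w′)
  suffixFrom w            (here refl) = w , id
  suffixFrom (step e j w) (there a∈) with suffixFrom w a∈
  ... | w′ , path = w′ , path ∘ IsPath-tail {e = e} {j = j} w

  module _ (_≟ᵛ_ : (x y : V) → Dec (x ≡ y)) where

    private
      _∈?ˡ_ : ∀ x xs → Dec (x ∈ˡ xs)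
      x ∈?ˡ xs = Any.any? (x ≟ᵛ_) xs

    eraseLoops : ∀ {x y} → Walk J x y → Σ[ w ∈ Walk J x y ] IsPath w
    eraseLoops stay = stay , [] ∷ []
    eraseLoops {x} (step e j w) with eraseLoops w
    ... | w′ , path with x ∈?ˡ (_ ∷ laterVertices w′)
    -- If `x` recurs on the path already built, everything before that occurrence is a loop and is
    -- dropped.
    ...   | yes x∈ = let w″ , p = suffixFrom w′ x∈ in w″ , p path
    ...   | no  x∉ = step e j w′ , unique-cons x∉ path

  -- Walks live over arbitrary incidence relations, so it has to be required that an edge has only
  -- one unordered pair of endpoints.
  Determined : Set
  Determined = ∀ {e a b c d} → J e a b → J e c d → (a ≡ c × b ≡ d) ⊎ (a ≡ d × b ≡ c)

  module _ (determined : Determined) where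

    edge-start∈ : ∀ {x y e a b} (w : Walk J x y) → e ∈ˡ edges w → J e a b →
                  a ∈ˡ x ∷ laterVertices w
    edge-start∈ (step e j w) (here refl) j′ with determined j′ j
    ... | inj₁ (refl , _) = here refl
    ... | inj₂ (refl , _) = there (here refl)
    edge-start∈ (step e j w) (there e∈)  j′ = there (edge-start∈ w e∈ j′)

    -- A repeated edge would bring the walk back to the vertex at which that edge was first taken.
    IsPath⇒IsTrail : ∀ {x y} (w : Walk J x y) → IsPath w → IsTrail w
    IsPath⇒IsTrail stay         _          = []
    IsPath⇒IsTrail (step e j w) (x∉ ∷ u) =
      unique-cons (λ e∈ → All¬⇒¬Any x∉ (edge-start∈ w e∈ j)) (IsPath⇒IsTrail w u)

module _ {V E : Set} {J : Incidence V E}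
         (_≟ᵛ_ : (x y : V) → Dec (x ≡ y)) (_≟ᵉ_ : (e f : E) → Dec (e ≡ f))
         (J-sym : ∀ {e x y} → J e x y → J e y x)
         (determined : Determined {J = J}) (acyclic : Acyclic J) where

  private
    -- Avoidance of `x` is built into the incidence relation, so that concatenation, reversal and
    -- loop erasure preserve it.
    Avoiding : V → Incidence V E
    Avoiding x e a b = J e a b × x ≢ a × x ≢ b

    avoid : ∀ {x y z} (w : Walk J y z) → x ∉ˡ y ∷ laterVertices w → Walk (Avoiding x) y z
    avoid stay         _  = stay
    avoid (step e j w) x∉ =
      step e (j , (λ eq → x∉ (here eq)) , (λ eq → x∉ (there (here eq)))) (avoid w (x∉ ∘ there))

    laterVertices-avoid : ∀ {x y z} (w : Walk (Avoiding x) y z) → x ∉ˡ laterVertices w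
    laterVertices-avoid (step e (_ , _ , x≢) w) (here eq)  = x≢ eq
    laterVertices-avoid (step e _ w)            (there x∈) = laterVertices-avoid w x∈

  -- Otherwise e, a path from y to z avoiding x, and f would form a cycle.
  unique-first-edge : ∀ {x y z r e f} {j : J e x y} {k : J f x z}
                      (w : Walk J y r) (v : Walk J z r) →
                      IsPath (step e j w) → IsPath (step f k v) → e ≡ f
  unique-first-edge {x} {y} {z} {e = e} {f} {j} {k} w v (x∉w ∷ _) (x∉v ∷ _) with e ≟ᵉ f
  ... | yes e≡f = e≡f
  ... | no  e≢f = ⊥-elim (acyclic cycle (s≤s z≤n , trail , subst Unique (sym later≡) later!))
    where
    detour : Walk (Avoiding x) y z
    detour = avoid w (All¬⇒¬Any x∉w) ⌢
             reverseWalk (λ { (j , a , b) → J-sym j , b , a }) (avoid v (All¬⇒¬Any x∉v))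

    erased = eraseLoops _≟ᵛ_ detour

    p : Walk J y z
    p = mapWalk proj₁ (proj₁ erased)

    x∉p : x ∉ˡ y ∷ laterVertices p
    x∉p (here eq)  = All.head x∉w eq
    x∉p (there x∈) = laterVertices-avoid (proj₁ erased)
      (subst (x ∈ˡ_) (laterVertices-mapWalk proj₁ (proj₁ erased)) x∈)

    p! : IsPath p
    p! = subst (λ vs → Unique (y ∷ vs)) (sym (laterVertices-mapWalk proj₁ (proj₁ erased)))
           (proj₂ erased)

    back : Walk J y x
    back = p ⌢ step f (J-sym k) stay

    cycle : Walk J x x
    cycle = step e j back

    later≡ : laterVertices cycle ≡ y ∷ laterVertices p ++ x ∷ []
    later≡ = cong (y ∷_) (laterVertices-⌢ p _)

    later! : Unique (y ∷ laterVertices p ++ x ∷ [])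
    later! = unique-snoc p! x∉p

    ∉p : ∀ {g a} → J g x a → g ∉ˡ edges p
    ∉p i g∈ = x∉p (edge-start∈ determined p g∈ i)

    e∉back : e ∉ˡ edges back
    e∉back e∈ with ∈-++⁻ (edges p) (subst (e ∈ˡ_) (edges-⌢ p _) e∈)
    ... | inj₁ e∈p       = ∉p j e∈p
    ... | inj₂ (here eq) = e≢f eq

    trail : IsTrail cycle
    trail = unique-cons e∉back (subst Unique (sym (edges-⌢ p _))
              (unique-snoc (IsPath⇒IsTrail determined p p!) (∉p k)))

  private
    end∈later : ∀ {x y z} {e} {j : J e x y} (w : Walk J y z) → z ∈ˡ laterVertices (step e j w)
    end∈later stay         = here refl
    end∈later (step e j w) = there (end∈later {e = e} {j = j} w)

  -- By `unique-first-edge` the two paths start with the same edge, and so they agree step by step.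
  path-length-unique : ∀ {x r} (w v : Walk J x r) → IsPath w → IsPath v →
                       length (edges w) ≡ length (edges v)
  path-length-unique stay stay _ _ = refl
  path-length-unique stay (step e j v) _ (x∉ ∷ _) =
    contradiction (end∈later {e = e} {j = j} v) (All¬⇒¬Any x∉)
  path-length-unique (step e j w) stay (x∉ ∷ _) _ =
    contradiction (end∈later {e = e} {j = j} w) (All¬⇒¬Any x∉)
  path-length-unique (step e j w) (step f k v) p q
    with refl ← unique-first-edge {j = j} {k = k} w v p q
    with determined j k
  ... | inj₁ (_ , refl) =
    cong suc (path-length-unique w v (IsPath-tail {j = j} w p) (IsPath-tail {j = k} v q))
  -- Here the common edge would be a loop at `x`; both paths still continue from the same vertex.
  ... | inj₂ (refl , refl) =
    cong suc (path-length-unique w v (IsPath-tail {j = j} w p) (IsPath-tail {j = k} v q))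

-- Forests oriented towards their roots.

-- Up e x y: the edge e leads from x to its parent y.
module Arborescence
    {k m : ℕ} {J : Incidence (Fin k) (Fin m)}
    (J-sym : ∀ {e x y} → J e x y → J e y x)
    (Up : Fin m → Fin k → Fin k → Set) (rank : Fin k → ℕ)
    (direction : ∀ {e x y} → J e x y → Up e x y ⊎ Up e y x)
    (Up-functional : ∀ {e f x y z} → Up e x y → Up f x z → e ≡ f × y ≡ z)
    (Up-rank : ∀ {e x y} → Up e x y → rank y < rank x) where

  -- A trail that has once gone down cannot turn around, because the only
  -- way up is the edge it has just used.
  descending : ∀ {e x y z} {j : J e x y} (w : Walk J y z) → IsTrail (step e j w) → Up e y x →
               rank x < rank z × ∃₂ λ f a → f ∈ˡ e ∷ edges w × Up f z a
  descending stay _ up = Up-rank up , _ , _ , here refl , up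
  descending (step f j w) ((e≢f ∷ _) ∷ u) up with direction j
  ... | inj₁ up′   = ⊥-elim (e≢f (proj₁ (Up-functional up up′)))
  ... | inj₂ down′ with descending {j = j} w u down′
  ...   | lt , g , a , g∈ , up″ = ℕ.<-trans (Up-rank up) lt , g , a , there g∈ , up″

  -- The first step that reaches a rank of at least that of `y` leads away from the root, and from
  -- there on the trail keeps descending.
  arrives-downwards : ∀ {x y} (w : Walk J x y) → IsTrail w → rank x < rank y →
                      ∃₂ λ f a → f ∈ˡ edges w × Up f y a
  arrives-downwards stay _ lt = ⊥-elim (ℕ.<-irrefl refl lt)
  arrives-downwards {x} {y} (step {y = z} e j w) t@(_ ∷ u) lt with rank z ℕ.<? rank y
  ... | yes lt′ = let f , a , f∈ , up = arrives-downwards w u lt′ in f , a , there f∈ , up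
  ... | no  ≮   with direction j
  ...   | inj₁ up   = ⊥-elim (ℕ.<-asym lt (ℕ.≤-<-trans (ℕ.≮⇒≥ ≮) (Up-rank up)))
  ...   | inj₂ down = proj₂ (descending {j = j} w t down)

  -- A closed trail that starts downwards would end at a larger rank than its own start; one that
  -- starts upwards would have to come back down through its first edge.
  acyclic : Acyclic J
  acyclic stay         (() , _)
  acyclic (step e j w) (_ , t@(e∉ ∷ u) , _) with direction j
  ... | inj₂ down = ℕ.<-irrefl refl (proj₁ (descending {j = j} w t down))
  ... | inj₁ up   with arrives-downwards w u (Up-rank up)
  ...   | f , a , f∈ , up′ =
    All¬⇒¬Any e∉ (subst (_∈ˡ edges w) (sym (proj₁ (Up-functional up up′))) f∈)

  -- After a step down, the only way up returns to the vertex just left, which a path cannot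
  -- revisit.
  path-stays-down : ∀ {e x y r} {j : J e x y} (w : Walk J y r) → IsPath (step e j w) →
                    Up e y x → ∃₂ λ f a → Up f r a
  path-stays-down stay _ down = _ , _ , down
  path-stays-down (step f j w) ((_ ∷ x≢z ∷ _) ∷ u) down with direction j
  ... | inj₁ up    = ⊥-elim (x≢z (proj₂ (Up-functional down up)))
  ... | inj₂ down′ = path-stays-down {j = j} w u down′

  -- Otherwise the path would descend all the way, and its end `r` would have a parent.
  first-step-up : ∀ {e x y r} {j : J e x y} (w : Walk J y r) → IsPath (step e j w) →
                  (∀ {f a} → ¬ Up f r a) → Up e x y
  first-step-up {j = j} w p root with direction j
  ... | inj₁ up   = up
  ... | inj₂ down = let _ , _ , up = path-stays-down {j = j} w p down in ⊥-elim (root up)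

  connected-roots : ∀ {r s} → (∀ {f a} → ¬ Up f r a) → (∀ {f a} → ¬ Up f s a) →
                    Walk J r s → r ≡ s
  connected-roots r-root s-root w with eraseLoops _≟_ w
  ... | stay        , _ = refl
  ... | step e j w′ , p = ⊥-elim (r-root (first-step-up {j = j} w′ p s-root))

just≢nothing : {A : Set} {m : Maybe A} {x : A} → m ≡ just x → m ≢ nothing
just≢nothing refl ()

-- Edges of the graph and of its induced subgraphs.

module _ (G : Graph) where
  open Graph G

  Joins-sym : ∀ {e u v} → Joins G e u v → Joins G e v u
  Joins-sym = swap

  Joins-determined : Determined {J = Joins G}
  Joins-determined (inj₁ p) (inj₁ q) = inj₁ (,-injective (trans (sym p) q))
  Joins-determined (inj₁ p) (inj₂ q) = inj₂ (,-injective (trans (sym p) q))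
  Joins-determined (inj₂ p) (inj₁ q) = let a , b = ,-injective (trans (sym p) q) in inj₂ (b , a)
  Joins-determined (inj₂ p) (inj₂ q) = let a , b = ,-injective (trans (sym p) q) in inj₁ (b , a)

  Joins-irreflexive : ∀ {e u} → ¬ Joins G e u u
  Joins-irreflexive {e} (inj₁ p) = loopless e (trans (cong proj₁ p) (sym (cong proj₂ p)))
  Joins-irreflexive {e} (inj₂ p) = loopless e (trans (cong proj₁ p) (sym (cong proj₂ p)))

  -- On (Inside U) is definitionally  JoinsIn (induced G U).
  On : (Edge → Set) → Incidence Vertex Edge
  On R e u v = R e × Joins G e u v

  On-sym : ∀ R {e u v} → On R e u v → On R e v u
  On-sym R (r , j) = r , Joins-sym j

  Inside : Pred Vertex 0ℓ → Edge → Set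
  Inside U e = U (proj₁ (ends e)) × U (proj₂ (ends e))

  inside⁺ : ∀ {U : Pred Vertex 0ℓ} {e u v} → Joins G e u v → U u → U v → Inside U e
  inside⁺ {U} (inj₁ eq) u∈ v∈ = subst (λ p → U (proj₁ p) × U (proj₂ p)) (sym eq) (u∈ , v∈)
  inside⁺ {U} (inj₂ eq) u∈ v∈ = subst (λ p → U (proj₁ p) × U (proj₂ p)) (sym eq) (v∈ , u∈)

  inside⁻ : ∀ {U : Pred Vertex 0ℓ} {e u v} → Inside U e → Joins G e u v → U u × U v
  inside⁻ {U} in-U (inj₁ eq) = subst (λ p → U (proj₁ p) × U (proj₂ p)) eq in-U
  inside⁻ {U} in-U (inj₂ eq) =
    let v∈ , u∈ = subst (λ p → U (proj₁ p) × U (proj₂ p)) eq in-U in u∈ , v∈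

-- Alternating trails with prescribed preceding and following edges.

module _ {C : Set} (G : Graph) (col : Graph.Edge G → C) where
  open Graph G

  Alt : List Edge → Set
  Alt = Linked (λ e f → col e ≢ col f)

  -- A trail from v to b whose edges satisfy R, to be preceded by the edges σ
  -- and followed by the edges τ without losing alternation.
  record Exit (R : Edge → Set) (σ : List Edge) (v b : Vertex) (τ : List Edge) : Set where
    constructor exit
    field
      walk  : Walk (On G R) v b
      trail : IsTrail walk
      alt   : Alt (σ ++ edges walk ++ τ)

  exit-empty : ∀ {R σ v τ} → Alt (σ ++ τ) → Exit R σ v v τ
  exit-empty alt = exit stay [] alt

  widen : ∀ {R R′ σ v b τ} → (∀ {e} → R e → R′ e) → Exit R σ v b τ → Exit R′ σ v b τ
  widen {R} {R′} {σ} {τ = τ} f (exit w t a) = exit (mapWalk g w)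
    (subst Unique (sym (edges-mapWalk g w)) t)
    (subst (λ es → Alt (σ ++ es ++ τ)) (sym (edges-mapWalk g w)) a)
    where
    g : ∀ {e x y} → On G R e x y → On G R′ e x y
    g (r , j) = f r , j

  enter-like : ∀ {R e f v b τ} → col f ≡ col e → Exit R (e ∷ []) v b τ → Exit R (f ∷ []) v b τ
  enter-like {e = e} {f} same (exit w t a) = exit w t (recolor a)
    where
    recolor : ∀ {es} → Alt (e ∷ es) → Alt (f ∷ es)
    recolor [-]     = [-]
    recolor (r ∷ l) = r ∘ trans (sym same) ∷ l

  -- Lets a trail towards the root be run from the root down, as the first half of a connecting
  -- trail or of a detour.
  backwards : ∀ {R σ v b τ} → Exit R σ v b τ → Exit R (reverse τ) b v (reverse σ)
  backwards {R} {σ = σ} {τ = τ} (exit w t a) = exit w′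
    (subst Unique (sym eq) (unique-reverse t))
    (subst Alt lists (linked-reverse (_∘ sym) a))
    where
    w′ = reverseWalk (On-sym G R) w
    eq = edges-reverse (On-sym G R) w
    open ≡-Reasoning
    lists : reverse (σ ++ edges w ++ τ) ≡ reverse τ ++ edges w′ ++ reverse σ
    lists = begin
      reverse (σ ++ edges w ++ τ)
        ≡⟨ reverse-++ σ _ ⟩
      reverse (edges w ++ τ) ++ reverse σ
        ≡⟨ cong (_++ reverse σ) (reverse-++ (edges w) τ) ⟩
      (reverse τ ++ reverse (edges w)) ++ reverse σ
        ≡⟨ ++-assoc (reverse τ) _ _ ⟩
      reverse τ ++ reverse (edges w) ++ reverse σ
        ≡⟨ cong (λ es → reverse τ ++ es ++ reverse σ) eq ⟨
      reverse τ ++ edges w′ ++ reverse σ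
        ∎

  -- Alternation passes through `p`, which both lists contain; distinctness holds because `R₁` and
  -- `R₂` are disjoint and `p` satisfies neither.
  glue : ∀ {R₁ R₂ R σ v b p y a τ} →
         Exit R₁ σ v b (p ∷ []) → Joins G p b y → Exit R₂ (p ∷ []) y a τ →
         (∀ {e} → R₁ e → R e) → R p → (∀ {e} → R₂ e → R e) →
         (∀ {e} → R₁ e → ¬ R₂ e) → ¬ R₁ p → ¬ R₂ p →
         Exit R σ v a τ
  glue {R₁} {R₂} {R} {σ} {p = p} {τ = τ}
       (exit w₁ t₁ a₁) j (exit w₂ t₂ a₂) R₁⊆R p∈R R₂⊆R disjoint p∉R₁ p∉R₂ = exit w
    (subst Unique (sym eq) (Uniqueₚ.++⁺ t₁ (unique-cons p∉w₂ t₂) apart))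
    (subst Alt lists
      (linked-join (σ ++ edges w₁) (subst Alt (sym (++-assoc σ (edges w₁) _)) a₁) a₂))
    where
    g₁ : ∀ {e x y} → On G R₁ e x y → On G R e x y
    g₁ (r , i) = R₁⊆R r , i
    g₂ : ∀ {e x y} → On G R₂ e x y → On G R e x y
    g₂ (r , i) = R₂⊆R r , i
    w = mapWalk g₁ w₁ ⌢ step p (p∈R , j) (mapWalk g₂ w₂)
    eq : edges w ≡ edges w₁ ++ p ∷ edges w₂
    eq = trans (edges-⌢ (mapWalk g₁ w₁) _)
           (cong₂ (λ es fs → es ++ p ∷ fs) (edges-mapWalk g₁ w₁) (edges-mapWalk g₂ w₂))
    p∉w₂ : p ∉ˡ edges w₂
    p∉w₂ p∈ = p∉R₂ (edges-satisfy proj₁ w₂ p∈)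
    apart : ∀ {e} → ¬ (e ∈ˡ edges w₁ × e ∈ˡ p ∷ edges w₂)
    apart (e∈ , here refl) = p∉R₁ (edges-satisfy proj₁ w₁ e∈)
    apart (e∈ , there e∈′) = disjoint (edges-satisfy proj₁ w₁ e∈)
                                      (edges-satisfy proj₁ w₂ e∈′)
    open ≡-Reasoning
    lists : (σ ++ edges w₁) ++ p ∷ edges w₂ ++ τ ≡ σ ++ edges w ++ τ
    lists = begin
      (σ ++ edges w₁) ++ p ∷ edges w₂ ++ τ   ≡⟨ ++-assoc σ _ _ ⟩
      σ ++ edges w₁ ++ p ∷ edges w₂ ++ τ     ≡⟨ cong (σ ++_) (++-assoc (edges w₁) _ _) ⟨
      σ ++ (edges w₁ ++ p ∷ edges w₂) ++ τ   ≡⟨ cong (λ es → σ ++ es ++ τ) eq ⟨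
      σ ++ edges w ++ τ                      ∎

  -- The second trail is entered through the first edge of the first one.
  two-trails : ∀ {R v b τ} → Edge → v ≢ b → (∀ e → Exit R (e ∷ []) v b τ) →
               Σ[ w ∈ Walk (On G R) v b ] Σ[ w′ ∈ Walk (On G R) v b ]
                 (IsTrail w × IsAlternating col w) ×
                 (IsTrail w′ × IsAlternating col w′) ×
                 (∃₂ λ e e′ → FirstEdge w e × FirstEdge w′ e′ × col e ≢ col e′) ×
                 Alt (edges w ++ τ) × Alt (edges w′ ++ τ)
  two-trails e₀ v≢b leave with leave e₀
  ... | exit stay _ _ = contradiction refl v≢b
  ... | exit w@(step e _ _) t a with leave e
  ...   | exit stay _ _ = contradiction refl v≢b
  ...   | exit w′@(step e′ _ _) t′ a′ =
    w , w′ , (t , linked-++⁻ˡ (edges w) (Linked.tail a) , ⊥-elim ∘ v≢b) ,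
    (t′ , linked-++⁻ˡ (edges w′) (Linked.tail a′) , ⊥-elim ∘ v≢b) ,
    (e , e′ , refl , refl , Linked.head a′) , Linked.tail a , Linked.tail a′

  module _ (_≟ᶜ_ : (e f : Edge) → Dec (col e ≡ col f)) where

    -- The color of `f` can agree with at most one of the two different first colors.
    exit-one-of-two : ∀ {R v b τ} (w w′ : Walk (On G R) v b) → IsTrail w → IsTrail w′ →
                      Alt (edges w ++ τ) → Alt (edges w′ ++ τ) →
                      (∃₂ λ e e′ → FirstEdge w e × FirstEdge w′ e′ × col e ≢ col e′) →
                      ∀ f → Exit R (f ∷ []) v b τ
    exit-one-of-two w w′ t t′ a a′ (e , e′ , first , first′ , e≢e′) f with f ≟ᶜ e
    ... | no  f≢e  = exit w t (linked-cons (head-++ first) f≢e a)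
    ... | yes same = exit w′ t′ (linked-cons (head-++ first′) (e≢e′ ∘ trans (sym same)) a′)

-- Frames

module _ {C : Set} (G : Graph) (col : Graph.Edge G → C) (S : Subset (Graph.order G)) where
  open Graph G

  exitEdge : Maybe (Edge × Vertex) → List Edge
  exitEdge nothing        = []
  exitEdge (just (e , _)) = e ∷ []

  exit-at : ∀ {R σ v a m m′} → m ≡ m′ →
            Exit G col R σ v a (exitEdge m) → Exit G col R σ v a (exitEdge m′)
  exit-at refl x = x

  -- A walk that arrives at v by e can be continued inside the block with base
  -- b so as to leave that block by its predecessor edge, if there is one.
  Good : (Vertex → Maybe Vertex) → (Vertex → Maybe (Edge × Vertex)) →
         Edge → Vertex → Vertex → Set
  Good lab link e v b =
    Exit G col (Inside G (λ u → lab u ≡ just b)) (e ∷ []) v b (exitEdge (link b))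

  -- A colored blossom forest whose blocks are named by their bases:  lab v
  -- is the base of the block of v, and  link b  consists of the predecessor
  -- edge of the block of b and its endpoint outside that block.
  record Frame : Set where
    field
      lab  : Vertex → Maybe Vertex
      link : Vertex → Maybe (Edge × Vertex)
      rank : Vertex → ℕ

    IsBase : Vertex → Set
    IsBase b = lab b ≡ just b

    -- One condition for root blossoms and `c`-blossoms alike: quantifying over the arriving edge
    -- replaces the pair of trails and, at a base with a link, the closed trail.
    Full : Vertex → Set
    Full b = ∀ {v} e → lab v ≡ just b → Good lab link e v b

    Inner : Vertex → Set
    Inner b = (∀ {v} → lab v ≡ just b → v ≡ b) × link b ≢ nothing

    Arc : Vertex → Edge → Vertex → Vertex → Set
    Arc b e y a = IsBase b × link b ≡ just (e , y) × lab y ≡ just a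

    field
      lab-base          : ∀ {v b} → lab v ≡ just b → IsBase b
      terminal-base     : ∀ {s} → s ∈ S → IsBase s
      terminal-unlinked : ∀ {s} → s ∈ S → link s ≡ nothing
      unlinked-terminal : ∀ {b} → IsBase b → link b ≡ nothing → b ∈ S
      link-joins        : ∀ {b e y} → IsBase b → link b ≡ just (e , y) → Joins G e b y
      link-target       : ∀ {b e y} → IsBase b → link b ≡ just (e , y) → ∃[ a ] lab y ≡ just a
      -- A decreasing rank takes the place of acyclicity and makes recursion towards the roots well
      -- founded.
      arc-rank          : ∀ {b e y a} → Arc b e y a → rank a < rank b
      -- Whoever climbs along the predecessor edge of a child can go on climbing from the parent; at
      -- an inner parent this is the color condition on its child edges.
      arc-good          : ∀ {b e y a} → Arc b e y a → Good lab link e y a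
      kind              : ∀ {b} → IsBase b → Full b ⊎ Inner b

  -- Ancestors and lowest common ancestors in a frame.

  module FrameProperties (B : Frame) where
    open Frame B

    same-label : ∀ {v a b} → lab v ≡ just a → lab v ≡ just b → a ≡ b
    same-label p q = just-injective (trans (sym p) q)

    joins : ∀ {b e y a} → Arc b e y a → Joins G e b y
    joins (base , eq , _) = link-joins base eq

    infix 4 _⤳_

    data _⤳_ : Vertex → Vertex → Set where
      here : ∀ {a} → a ⤳ a
      up   : ∀ {b e y c a} → Arc b e y c → c ⤳ a → b ⤳ a

    ⤳-trans : ∀ {a b c} → a ⤳ b → b ⤳ c → a ⤳ c
    ⤳-trans here       q = q
    ⤳-trans (up arc p) q = up arc (⤳-trans p q)

    ⤳-base : ∀ {a b} → IsBase a → a ⤳ b → IsBase b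
    ⤳-base base here                  = base
    ⤳-base base (up (_ , _ , eq) p) = ⤳-base (lab-base eq) p

    ⤳-rank : ∀ {a b} → a ⤳ b → rank b ≤ rank a
    ⤳-rank here       = ℕ.≤-refl
    ⤳-rank (up arc p) = ℕ.≤-trans (⤳-rank p) (ℕ.<⇒≤ (arc-rank arc))

    arc-⤳̸ : ∀ {b e y a c} → Arc b e y a → a ⤳ c → c ≢ b
    arc-⤳̸ arc p refl = ℕ.<⇒≱ (arc-rank arc) (⤳-rank p)

    ⤳-antisym : ∀ {a b} → a ⤳ b → b ⤳ a → a ≡ b
    ⤳-antisym here       _ = refl
    ⤳-antisym (up arc p) q = ⊥-elim (arc-⤳̸ arc (⤳-trans p q) refl)

    arc-functional : ∀ {b e y a f z c} → Arc b e y a → Arc b f z c → e ≡ f × y ≡ z × a ≡ c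
    arc-functional (_ , p , q) (_ , p′ , q′) with just-injective (trans (sym p) p′)
    ... | refl = refl , refl , same-label q q′

    ⤳-via : ∀ {b e y c a} → Arc b e y c → b ⤳ a → b ≢ a → c ⤳ a
    ⤳-via arc here        b≢a = ⊥-elim (b≢a refl)
    ⤳-via arc (up arc′ p) _ with arc-functional arc arc′
    ... | refl , refl , refl = p

    isBase? : ∀ b → Dec (IsBase b)
    isBase? b = ≡-dec _≟_ (lab b) (just b)

    isLink? : ∀ e → Dec (∃[ b ] IsBase b × ∃[ y ] link b ≡ just (e , y))
    isLink? e = any? λ b → isBase? b ×-dec linked-by? b
      where
      linked-by? : ∀ b → Dec (∃[ y ] link b ≡ just (e , y))
      linked-by? b with link b
      ... | nothing = no λ ()
      ... | just (f , y) with f ≟ e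
      ...   | yes refl = yes (y , refl)
      ...   | no  f≢e  = no λ { (_ , refl) → f≢e refl }

    unlinked-top : ∀ {b a} → link b ≡ nothing → b ⤳ a → b ≡ a
    unlinked-top _  here                 = refl
    unlinked-top eq (up (_ , eq′ , _) _) with () ← trans (sym eq) eq′

    parent : ∀ {b} → IsBase b → link b ≡ nothing ⊎ ∃ λ e → ∃₂ λ y a → Arc b e y a
    parent {b} base with link b in eq
    ... | nothing      = inj₁ refl
    ... | just (e , y) =
      let a , eq′ = link-target base eq in inj₂ (e , y , a , base , refl , eq′)

    private
      below : ∀ b → Acc _<_ (rank b) → IsBase b → ∀ a → Dec (b ⤳ a)
      below b (acc rec) base a with b ≟ a
      ... | yes refl = yes here
      ... | no  b≢a with parent base
      ...   | inj₁ eq = no (b≢a ∘ unlinked-top eq)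
      ...   | inj₂ (_ , _ , c , arc) =
        map′ (up arc) (λ p → ⤳-via arc p b≢a)
             (below c (rec (arc-rank arc)) (lab-base (proj₂ (proj₂ arc))) a)

    ⤳? : ∀ {b} → IsBase b → ∀ a → Dec (b ⤳ a)
    ⤳? base = below _ (<-wellFounded _) base

    private
      climbToRoot : ∀ b → Acc _<_ (rank b) → IsBase b → ∃[ s ] s ∈ S × b ⤳ s
      climbToRoot b (acc rec) base with parent base
      ... | inj₁ eq = b , unlinked-terminal base eq , here
      ... | inj₂ (_ , _ , c , arc) =
        let s , s∈ , p = climbToRoot c (rec (arc-rank arc)) (lab-base (proj₂ (proj₂ arc)))
        in s , s∈ , up arc p

    toRoot : ∀ {b} → IsBase b → ∃[ s ] s ∈ S × b ⤳ s
    toRoot = climbToRoot _ (<-wellFounded _)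

    -- In `Meet` the vertex `d` is the lowest common ancestor; `NoMeet` says that the two blocks lie
    -- in different trees.
    Meet NoMeet : Vertex → Vertex → Set
    Meet b c   = ∃[ d ] b ⤳ d × c ⤳ d × (∀ a → b ⤳ a → c ⤳ a → d ⤳ a)
    NoMeet b c = ∀ a → b ⤳ a → ¬ c ⤳ a

    private
      -- Climbing from `b`, the first base that is also above `c` is the lowest common ancestor.
      meetFrom : ∀ b → Acc _<_ (rank b) → IsBase b → ∀ {c} → IsBase c → Meet b c ⊎ NoMeet b c
      meetFrom b (acc rec) base base′ with ⤳? base′ b
      ... | yes p = inj₁ (b , here , p , λ _ q _ → q)
      ... | no ≠b with parent base
      ...   | inj₁ eq = inj₂ λ a p q → ≠b (subst (_ ⤳_) (sym (unlinked-top eq p)) q)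
      ...   | inj₂ (_ , _ , c , arc)
              with meetFrom c (rec (arc-rank arc)) (lab-base (proj₂ (proj₂ arc))) base′
      ...     | inj₁ (d , p , q , least) =
                inj₁ (d , up arc p , q , λ a p′ q′ →
                  least a (⤳-via arc p′ λ { refl → ≠b q′ }) q′)
      ...     | inj₂ none =
                inj₂ λ a p q → none a (⤳-via arc p λ { refl → ≠b q }) q

    meet : ∀ {b c} → IsBase b → IsBase c → Meet b c ⊎ NoMeet b c
    meet base = meetFrom _ (<-wellFounded _) base

    -- Edges owned by blocks, and trails climbing towards a root.

    Within : Vertex → Edge → Set
    Within b = Inside G (λ u → lab u ≡ just b)

    -- Assigns each edge inside a block and each predecessor edge to one block, so that trails
    -- through different blocks are edge-disjoint.
    Belongs : Vertex → Edge → Set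
    Belongs b e = Within b e ⊎ ∃₂ λ y a → Arc b e y a

    within-¬arc : ∀ {b c e y a} → Within b e → ¬ Arc c e y a
    within-¬arc w arc@(base , _ , eq) with inside⁻ G w (joins arc)
    ... | p , q with same-label p base | same-label q eq
    ...   | refl | refl = ℕ.<-irrefl refl (arc-rank arc)

    belongs-unique : ∀ {b c e} → Belongs b e → Belongs c e → b ≡ c
    belongs-unique (inj₁ w) (inj₁ w′) = same-label (proj₁ w) (proj₁ w′)
    belongs-unique (inj₁ w) (inj₂ (_ , _ , arc)) = ⊥-elim (within-¬arc w arc)
    belongs-unique (inj₂ (_ , _ , arc)) (inj₁ w) = ⊥-elim (within-¬arc w arc)
    belongs-unique (inj₂ (_ , _ , arc)) (inj₂ (_ , _ , arc′))
      with Joins-determined G (joins arc) (joins arc′)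
    ... | inj₁ (refl , _) = refl
    -- Used in opposite directions, the edge would make each block the parent of the other.
    ... | inj₂ (refl , refl)
          with same-label (proj₂ (proj₂ arc)) (proj₁ arc′)
             | same-label (proj₂ (proj₂ arc′)) (proj₁ arc)
    ...     | refl | refl = ⊥-elim (ℕ.<-asym (arc-rank arc) (arc-rank arc′))

    -- The edges available for climbing from `b` to its ancestor `a`. The arc of `a` is excluded,
    -- since the climb stops there and this arc is the edge that follows it.
    Route : Vertex → Vertex → Edge → Set
    Route b a e =
      ∃[ c ] b ⤳ c × c ⤳ a × (Within c e ⊎ (c ≢ a × ∃₂ λ y d → Arc c e y d))

    route-belongs : ∀ {b a e} ((c , _) : Route b a e) → Belongs c e
    route-belongs (_ , _ , _ , inj₁ w)         = inj₁ w
    route-belongs (_ , _ , _ , inj₂ (_ , arc)) = inj₂ arc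

    route-inside : ∀ {P : Vertex → Set} {b a e} → (∀ c → b ⤳ c → c ⤳ a → P c) → Route b a e →
                   Inside G (λ u → ∃[ c ] lab u ≡ just c × P c) e
    route-inside P⁺ (c , p , q , inj₁ (l , r)) = (c , l , P⁺ c p q) , (c , r , P⁺ c p q)
    route-inside P⁺ (c , p , q , inj₂ (c≢a , y , d , arc@(base , _ , eq))) =
      inside⁺ G (joins arc) (c , base , P⁺ c p q)
        (d , eq , P⁺ d (⤳-trans p (up arc here)) (⤳-via arc q c≢a))

    -- Induction along the chain: cross the block, take its link, and continue from the parent,
    -- where `arc-good` makes the arrival good.
    climb : ∀ {e v b a} → lab v ≡ just b → b ⤳ a → Good lab link e v b →
            Exit G col (Route b a) (e ∷ []) v a (exitEdge (link a))
    climb _ here good = widen G col (λ w → _ , here , here , inj₁ w) good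
    climb {b = b} eq (up {e = p} {c = c} arc@(_ , link≡ , eq′) q) good =
      glue G col (exit-at link≡ good) (joins arc)
        (climb eq′ q (arc-good arc))
        (λ w → b , here , up arc q , inj₁ w)
        (b , here , up arc q , inj₂ ((arc-⤳̸ arc q ∘ sym) , _ , _ , arc))
        (λ { (d , q₁ , q₂ , x) → d , up arc q₁ , q₂ , x })
        (λ w r → not-below r (inj₁ w))
        (λ w → within-¬arc w arc)
        (λ r → not-below r (inj₂ (_ , _ , arc)))
      where
      not-below : ∀ {e a} → Route c a e → ¬ Belongs b e
      not-below r@(_ , q₁ , _) x = arc-⤳̸ arc q₁ (belongs-unique (route-belongs r) x)

    inner-loopless : ∀ {a e} → Inner a → ¬ Within a e
    inner-loopless {e = e} (single , _) (l , r) =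
      loopless e (trans (single l) (sym (single r)))

    crossing-arc : ∀ {e x y b c d z a} → Joins G e x y → lab x ≡ just b → lab y ≡ just c →
                   Arc d e z a → (b ≡ d × c ≡ a) ⊎ (c ≡ d × b ≡ a)
    crossing-arc j lx ly arc@(base , _ , lz) with Joins-determined G j (joins arc)
    ... | inj₁ (refl , refl) = inj₁ (same-label lx base , same-label ly lz)
    ... | inj₂ (refl , refl) = inj₂ (same-label ly base , same-label lx lz)

    crossing-¬within : ∀ {e x y b c d} → Joins G e x y → lab x ≡ just b → lab y ≡ just c →
                       b ≢ c → ¬ Within d e
    crossing-¬within j lx ly b≢c w with inside⁻ G w j
    ... | p , q = b≢c (trans (same-label lx p) (same-label q ly))

    -- The reversed climb from `x`, the edge `e` and the climb from `y` fit together, because routes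
    -- in different trees share no block and hence no edge.
    connecting : ∀ {e x y b c} → Joins G e x y → lab x ≡ just b → lab y ≡ just c →
                 Good lab link e x b → Good lab link e y c → NoMeet b c →
                 HasConnectingTrail G col S
    connecting {e} {x} {y} {b} {c} j lx ly gx gy none
      with toRoot (lab-base lx) | toRoot (lab-base ly)
    ... | s , s∈ , p | t , t∈ , q
      with glue G col {R = λ _ → ⊤}
             (backwards G col (exit-at (terminal-unlinked s∈) (climb lx p gx))) j
             (exit-at (terminal-unlinked t∈) (climb ly q gy))
             _ _ _ apart (λ r → foreign (route-belongs r)) (λ r → foreign (route-belongs r))
      where
      apart : ∀ {f} → Route b s f → ¬ Route c t f
      apart r@(d , p₁ , _) r′@(d′ , q₁ , _)
        with refl ← belongs-unique (route-belongs r) (route-belongs r′) = none d p₁ q₁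
      -- An edge inside a block or along an arc has both ends in one tree, so `e` lies on neither
      -- route.
      foreign : ∀ {d} → ¬ Belongs d e
      foreign (inj₁ w) = crossing-¬within j lx ly (λ { refl → none b here here }) w
      foreign (inj₂ (_ , _ , arc)) with crossing-arc j lx ly arc
      ... | inj₁ (refl , refl) = none c (up arc here) here
      ... | inj₂ (refl , refl) = none b here (up arc here)
    ... | exit w t! alt =
      s , t , s∈ , t∈ , s≢t , mapWalk proj₂ w ,
      subst Unique (sym (edges-mapWalk proj₂ w)) t! ,
      subst (Alt G col) (trans (++-identityʳ _) (sym (edges-mapWalk proj₂ w))) alt ,
      ⊥-elim ∘ s≢t
      where
      s≢t : s ≢ t
      s≢t refl = none s p q

    -- Around the cycle formed by e and the routes from its two ends to D,
    -- in the direction in which a is left downwards.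
    detour : ∀ {e x y b c D a p z} → Joins G e x y → lab x ≡ just b → lab y ≡ just c →
             Good lab link e x b → Good lab link e y c → (∀ {d} → ¬ Belongs d e) →
             b ⤳ a → a ⤳ D → c ⤳ D → (∀ d → b ⤳ d → c ⤳ d → D ⤳ d) →
             Inner a → link a ≡ just (p , z) →
             Exit G col (λ f → Route b a f ⊎ f ≡ e ⊎ Route c D f) (p ∷ []) a D (exitEdge (link D))
    detour {e} {b = b} {c} {D} {a} j lx ly gx gy foreign b⤳a a⤳D c⤳D least inner eq =
      glue G col
        (backwards G col (exit-at eq (climb lx b⤳a gx))) j
        (climb ly c⤳D gy)
        inj₁ (inj₂ (inj₁ refl)) (inj₂ ∘ inj₂)
        apart (foreign ∘ route-belongs) (foreign ∘ route-belongs)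
      where
      apart : ∀ {f} → Route b a f → ¬ Route c D f
      -- A block on both routes can only be `D`, and then `a` is `D` too; but an inner block
      -- contains no edge, and the arc of `a` is not on the route to `a`.
      apart r@(d , p₁ , p₂ , x) r′@(_ , q₁ , q₂ , _)
        with refl ← belongs-unique (route-belongs r) (route-belongs r′)
        with refl ← ⤳-antisym (least d p₁ q₁) q₂
        with refl ← ⤳-antisym p₂ a⤳D
        with x
      ... | inj₁ w         = inner-loopless inner w
      ... | inj₂ (d≢a , _) = d≢a refl

    -- Contracting a set of blocks into one block with base `D`.

    module Merge (D : Vertex) {T : Vertex → Set} (T? : ∀ b → Dec (T b))
                 (D-base : IsBase D) (T-D : T D) (T-⤳ : ∀ {b} → T b → b ⤳ D)
                 (full : ∀ {v b} e → lab v ≡ just b → T b →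
                         Exit G col (Inside G (λ u → ∃[ c ] lab u ≡ just c × T c))
                           (e ∷ []) v D (exitEdge (link D))) where

      collapse : Vertex → Vertex
      collapse b with T? b
      ... | yes _ = D
      ... | no  _ = b

      collapse-T : ∀ {b} → T b → collapse b ≡ D
      collapse-T {b} t with T? b
      ... | yes _ = refl
      ... | no ¬t = contradiction t ¬t

      collapse-¬T : ∀ {b} → ¬ T b → collapse b ≡ b
      collapse-¬T {b} ¬t with T? b
      ... | yes t = contradiction t ¬t
      ... | no _  = refl

      mergedLab : Vertex → Maybe Vertex
      mergedLab v = Maybe.map collapse (lab v)

      mergedLab⁺ : ∀ {v b} → lab v ≡ just b → mergedLab v ≡ just (collapse b)
      mergedLab⁺ eq = cong (Maybe.map collapse) eq

      mergedLab-T : ∀ {v b} → lab v ≡ just b → T b → mergedLab v ≡ just D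
      mergedLab-T eq t = trans (mergedLab⁺ eq) (cong just (collapse-T t))

      mergedLab-¬T : ∀ {v b} → lab v ≡ just b → ¬ T b → mergedLab v ≡ just b
      mergedLab-¬T eq ¬t = trans (mergedLab⁺ eq) (cong just (collapse-¬T ¬t))

      mergedLab⁻ : ∀ {v d} → mergedLab v ≡ just d →
                   ∃[ b ] lab v ≡ just b × ((T b × d ≡ D) ⊎ (¬ T b × d ≡ b))
      mergedLab⁻ {v} eq with lab v
      mergedLab⁻ refl | just b with T? b
      ... | yes t = b , refl , inj₁ (t , refl)
      ... | no ¬t = b , refl , inj₂ (¬t , refl)

      mergedLab⁻-¬T : ∀ {v b} → ¬ T b → mergedLab v ≡ just b → lab v ≡ just b
      mergedLab⁻-¬T ¬t eq with mergedLab⁻ eq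
      ... | _ , _ , inj₁ (_ , refl) = contradiction T-D ¬t
      ... | _ , l , inj₂ (_ , refl) = l

      mergedBase⁻ : ∀ {b} → mergedLab b ≡ just b → IsBase b × (b ≡ D ⊎ ¬ T b)
      mergedBase⁻ eq with mergedLab⁻ eq
      ... | _ , _   , inj₁ (_ , refl)  = D-base , inj₁ refl
      ... | _ , eq′ , inj₂ (¬t , refl) = eq′ , inj₂ ¬t

      MergedArc : Vertex → Edge → Vertex → Vertex → Set
      MergedArc b e y a = mergedLab b ≡ just b × link b ≡ just (e , y) × mergedLab y ≡ just a

      mergedArc⁻ : ∀ {b e y a} → MergedArc b e y a →
                   ∃[ c ] Arc b e y c × ((T c × a ≡ D) ⊎ (¬ T c × a ≡ c))
      mergedArc⁻ (base , eq , eq′) with mergedLab⁻ eq′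
      ... | c , eq″ , cases = c , (proj₁ (mergedBase⁻ base) , eq , eq″) , cases

      into-D : ∀ {e} → Inside G (λ u → ∃[ c ] lab u ≡ just c × T c) e →
               Inside G (λ u → mergedLab u ≡ just D) e
      into-D ((_ , l , t) , (_ , l′ , t′)) = mergedLab-T l t , mergedLab-T l′ t′

      outside-T : ∀ {b e} → ¬ T b → Within b e → Inside G (λ u → mergedLab u ≡ just b) e
      outside-T ¬t (l , r) = mergedLab-¬T l ¬t , mergedLab-¬T r ¬t

      mergedKind : ∀ {b} → mergedLab b ≡ just b →
                   (∀ {v} e → mergedLab v ≡ just b → Good mergedLab link e v b) ⊎
                   ((∀ {v} → mergedLab v ≡ just b → v ≡ b) × link b ≢ nothing)
      mergedKind base with mergedBase⁻ base
      ... | _ , inj₁ refl = inj₁ λ e eq → exitD e (mergedLab⁻ eq)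
        where
        exitD : ∀ {v} e → ∃[ b ] lab v ≡ just b × ((T b × D ≡ D) ⊎ (¬ T b × D ≡ b)) →
                Good mergedLab link e v D
        exitD e (_ , l , inj₁ (t , _))     = widen G col into-D (full e l t)
        exitD e (_ , l , inj₂ (¬t , refl)) = contradiction T-D ¬t
      ... | base′ , inj₂ ¬t with kind base′
      ...   | inj₁ full′ = inj₁ λ e eq → widen G col (outside-T ¬t) (full′ e (mergedLab⁻-¬T ¬t eq))
      ...   | inj₂ (single , linked) = inj₂ (single ∘ mergedLab⁻-¬T ¬t , linked)

      -- Links and ranks are kept: the new block inherits those of `D`, and the links of absorbed
      -- bases no longer count as arcs.
      merged : Frame
      merged = record
        { lab               = mergedLab
        ; link              = link
        ; rank              = rank
        ; lab-base          = λ eq → base (mergedLab⁻ eq)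
        ; terminal-base     = terminal
        ; terminal-unlinked = terminal-unlinked
        ; unlinked-terminal = unlinked-terminal ∘ proj₁ ∘ mergedBase⁻
        ; link-joins        = link-joins ∘ proj₁ ∘ mergedBase⁻
        ; link-target       = λ b eq →
            let _ , l = link-target (proj₁ (mergedBase⁻ b)) eq in _ , mergedLab⁺ l
        ; arc-rank          = λ arc → lower (mergedArc⁻ arc)
        ; arc-good          = λ arc → good (mergedArc⁻ arc)
        ; kind              = mergedKind
        }
        where
        base : ∀ {v d} → ∃[ b ] lab v ≡ just b × ((T b × d ≡ D) ⊎ (¬ T b × d ≡ b)) →
               mergedLab d ≡ just d
        base (_ , _ , inj₁ (_ , refl))  = mergedLab-T D-base T-D
        base (_ , l , inj₂ (¬t , refl)) = mergedLab-¬T (lab-base l) ¬t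

        terminal : ∀ {s} → s ∈ S → mergedLab s ≡ just s
        terminal {s} s∈ with T? s
        ... | no ¬t = mergedLab-¬T (terminal-base s∈) ¬t
        -- A terminal has no proper ancestor, so an absorbed terminal must be `D` itself.
        ... | yes t with refl ← unlinked-top (terminal-unlinked s∈) (T-⤳ t) =
          mergedLab-T D-base t

        lower : ∀ {b e y a} → ∃[ c ] Arc b e y c × ((T c × a ≡ D) ⊎ (¬ T c × a ≡ c)) →
                rank a < rank b
        -- The old parent was absorbed, and `D` lies at or above it.
        lower (_ , arc , inj₁ (t , refl)) = ℕ.≤-<-trans (⤳-rank (T-⤳ t)) (arc-rank arc)
        lower (_ , arc , inj₂ (_ , refl)) = arc-rank arc

        good : ∀ {b e y a} → ∃[ c ] Arc b e y c × ((T c × a ≡ D) ⊎ (¬ T c × a ≡ c)) →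
               Good mergedLab link e y a
        good (_ , (_ , _ , l) , inj₁ (t , refl)) = widen G col into-D (full _ l t)
        good (_ , arc , inj₂ (¬t , refl))        = widen G col (outside-T ¬t) (arc-good arc)

    -- Adding an uncovered vertex as an inner vertex.

    module Extend {e x y b} (j : Joins G e x y) (lx : lab x ≡ just b) (ly : lab y ≡ nothing)
                  (gx : Good lab link e x b) where

      update : {A : Set} → (Vertex → A) → A → Vertex → A
      update f a v with v ≟ y
      ... | yes _ = a
      ... | no  _ = f v

      update-here : {A : Set} (f : Vertex → A) (a : A) → update f a y ≡ a
      update-here f a with y ≟ y
      ... | yes _  = refl
      ... | no y≢y = contradiction refl y≢y

      update-there : {A : Set} (f : Vertex → A) (a : A) {v : Vertex} → v ≢ y → update f a v ≡ f v
      update-there f a {v} v≢y with v ≟ y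
      ... | yes v≡y = contradiction v≡y v≢y
      ... | no _    = refl

      labelled-≢ : ∀ {v c} → lab v ≡ just c → v ≢ y
      labelled-≢ eq refl = just≢nothing eq ly

      extLab : Vertex → Maybe Vertex
      extLab = update lab (just y)

      extLink : Vertex → Maybe (Edge × Vertex)
      extLink = update link (just (e , x))

      extRank : Vertex → ℕ
      extRank = update rank (suc (rank b))

      extLab⁺ : ∀ {v c} → lab v ≡ just c → extLab v ≡ just c
      extLab⁺ eq = trans (update-there lab (just y) (labelled-≢ eq)) eq

      extLab⁻ : ∀ {v c} → extLab v ≡ just c → (v ≡ y × c ≡ y) ⊎ (v ≢ y × c ≢ y × lab v ≡ just c)
      extLab⁻ {v} eq with v ≟ y
      extLab⁻ refl | yes v≡y = inj₁ (v≡y , refl)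
      extLab⁻ eq   | no  v≢y = inj₂ (v≢y , labelled-≢ (lab-base eq) , eq)

      extLab⁻-there : ∀ {v c} → c ≢ y → extLab v ≡ just c → lab v ≡ just c
      extLab⁻-there {v} c≢y eq with extLab⁻ {v} eq
      ... | inj₁ (_ , c≡y)   = contradiction c≡y c≢y
      ... | inj₂ (_ , _ , l) = l

      extLink-there : ∀ {c} → c ≢ y → extLink c ≡ link c
      extLink-there = update-there link _

      extRank-there : ∀ {c} → c ≢ y → extRank c ≡ rank c
      extRank-there = update-there rank _

      extLink-here : extLink y ≡ just (e , x)
      extLink-here = update-here link _

      ExtArc : Vertex → Edge → Vertex → Vertex → Set
      ExtArc c f z a = extLab c ≡ just c × extLink c ≡ just (f , z) × extLab z ≡ just a

      extArc⁻ : ∀ {c f z a} → ExtArc c f z a →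
                (c ≡ y × f ≡ e × z ≡ x × a ≡ b) ⊎ (c ≢ y × a ≢ y × Arc c f z a)
      extArc⁻ {c} (base , eq , eq′) with c ≟ y
      extArc⁻ {z = z} (base , refl , eq′) | yes refl with extLab⁻ {z} eq′
      ... | inj₁ (refl , _) = contradiction lx λ l → just≢nothing l ly
      ... | inj₂ (_ , _ , l) = inj₁ (refl , refl , refl , same-label l lx)
      extArc⁻ {z = z} (base , eq , eq′) | no c≢y with extLab⁻ {z} eq′
      ... | inj₂ (_ , a≢y , l) = inj₂ (c≢y , a≢y , base , eq , l)
      ... | inj₁ (refl , _) with link-target base eq
      ...   | _ , l = contradiction l λ l → just≢nothing l ly

      extGood : ∀ {f v c} → c ≢ y → Good lab link f v c → Good extLab extLink f v c
      extGood c≢y good =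
        exit-at (sym (extLink-there c≢y)) (widen G col (λ { (l , r) → extLab⁺ l , extLab⁺ r }) good)

      -- The only new arc is `e`, which is good at `x` by assumption; the exits of the old blocks
      -- never involve `y` and carry over.
      extended : Frame
      extended = record
        { lab               = extLab
        ; link              = extLink
        ; rank              = extRank
        ; lab-base          = λ {v} eq → base (extLab⁻ {v} eq)
        ; terminal-base     = extLab⁺ ∘ terminal-base
        ; terminal-unlinked = λ s∈ →
            trans (extLink-there (labelled-≢ (terminal-base s∈))) (terminal-unlinked s∈)
        ; unlinked-terminal = unlinked
        ; link-joins        = joins′
        ; link-target       = target
        ; arc-rank          = λ arc → lower (extArc⁻ arc)
        ; arc-good          = λ arc → good (extArc⁻ arc)
        ; kind              = λ {c} eq → kind′ (extLab⁻ {c} eq)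
        }
        where
        base : ∀ {v c} → (v ≡ y × c ≡ y) ⊎ (v ≢ y × c ≢ y × lab v ≡ just c) → extLab c ≡ just c
        base (inj₁ (_ , refl))  = update-here lab (just y)
        base (inj₂ (_ , _ , l)) = extLab⁺ (lab-base l)

        unlinked : ∀ {c} → extLab c ≡ just c → extLink c ≡ nothing → c ∈ S
        unlinked {c} eq eq′ with c ≟ y
        unlinked eq () | yes _
        ... | no _ = unlinked-terminal eq eq′

        joins′ : ∀ {c f z} → extLab c ≡ just c → extLink c ≡ just (f , z) → Joins G f c z
        joins′ {c} eq eq′ with c ≟ y
        joins′ eq refl | yes refl = Joins-sym G j
        ... | no _ = link-joins eq eq′

        target : ∀ {c f z} → extLab c ≡ just c → extLink c ≡ just (f , z) → ∃[ a ] extLab z ≡ just a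
        target {c} eq eq′ with c ≟ y
        target eq refl | yes refl = b , extLab⁺ lx
        ... | no _ = let a , l = link-target eq eq′ in a , extLab⁺ l

        lower : ∀ {c f z a} → (c ≡ y × f ≡ e × z ≡ x × a ≡ b) ⊎ (c ≢ y × a ≢ y × Arc c f z a) →
                extRank a < extRank c
        lower (inj₁ (refl , refl , refl , refl)) = subst₂ _<_
          (sym (extRank-there (labelled-≢ (lab-base lx)))) (sym (update-here rank _)) ℕ.≤-refl
        lower (inj₂ (c≢y , a≢y , arc)) = subst₂ _<_
          (sym (extRank-there a≢y)) (sym (extRank-there c≢y)) (arc-rank arc)

        good : ∀ {c f z a} → (c ≡ y × f ≡ e × z ≡ x × a ≡ b) ⊎ (c ≢ y × a ≢ y × Arc c f z a) →
               Good extLab extLink f z a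
        good (inj₁ (refl , refl , refl , refl)) = extGood (labelled-≢ (lab-base lx)) gx
        good (inj₂ (_ , a≢y , arc))             = extGood a≢y (arc-good arc)

        kind′ : ∀ {c} → (c ≡ y × c ≡ y) ⊎ (c ≢ y × c ≢ y × IsBase c) →
                (∀ {v} f → extLab v ≡ just c → Good extLab extLink f v c) ⊎
                ((∀ {v} → extLab v ≡ just c → v ≡ c) × extLink c ≢ nothing)
        kind′ (inj₁ (refl , _)) = inj₂ (only , just≢nothing extLink-here)
          where
          only : ∀ {v} → extLab v ≡ just y → v ≡ y
          only {v} eq with extLab⁻ {v} eq
          ... | inj₁ (v≡y , _)     = v≡y
          ... | inj₂ (_ , y≢y , _) = contradiction refl y≢y
        kind′ {c} (inj₂ (c≢y , _ , base)) with kind base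
        ... | inj₁ full = inj₁ λ f eq → extGood c≢y (full f (extLab⁻-there c≢y eq))
        ... | inj₂ (single , linked) =
          inj₂ (single ∘ extLab⁻-there c≢y , linked ∘ trans (sym (extLink-there c≢y)))

    -- Contracting fundamental cycles, and the consequences of maximality.

    module _ (_≟ᶜ_ : (e f : Edge) → Dec (col e ≡ col f)) where

      -- At an inner vertex the exit is the empty walk, which fails only if `f` and the link have
      -- the same color.
      good-or-blocked : ∀ {v b} f → lab v ≡ just b →
                        Good lab link f v b ⊎
                        (v ≡ b × Inner b × ∃₂ λ p z → link b ≡ just (p , z) × col f ≡ col p)
      good-or-blocked {v} {b} f eq with kind (lab-base eq)
      ... | inj₁ full = inj₁ (full f eq)
      ... | inj₂ inner@(single , linked) with single eq
      ...   | refl with parent (lab-base eq)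
      ...     | inj₁ none = ⊥-elim (linked none)
      ...     | inj₂ (p , z , _ , _ , link≡ , _) with f ≟ᶜ p
      ...       | yes same = inj₂ (refl , inner , p , z , link≡ , same)
      ...       | no  f≢p  = inj₁ (exit-empty G col
                    (subst (λ m → Alt G col (f ∷ exitEdge m)) (sym link≡) (f≢p ∷ [-])))

      -- If `D` is the lowest common ancestor of `b` and `c`, these are the bases of the blocks on
      -- the fundamental cycle of an edge joining the blocks of `b` and `c`.
      OnRoutes : Vertex → Vertex → Vertex → Vertex → Set
      OnRoutes b c D a = (b ⤳ a × a ⤳ D) ⊎ (c ⤳ a × a ⤳ D)

      onRoutes-⤳ : ∀ {b c D a} → OnRoutes b c D a → a ⤳ D
      onRoutes-⤳ (inj₁ (_ , q)) = q
      onRoutes-⤳ (inj₂ (_ , q)) = q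

      onRoutes-above : ∀ {b c D a d} → OnRoutes b c D a → a ⤳ d → d ⤳ D → OnRoutes b c D d
      onRoutes-above (inj₁ (p , _)) q q′ = inj₁ (⤳-trans p q , q′)
      onRoutes-above (inj₂ (p , _)) q q′ = inj₂ (⤳-trans p q , q′)

      cycle-full : ∀ {e x y b c D} → Joins G e x y → lab x ≡ just b → lab y ≡ just c →
                   Good lab link e x b → Good lab link e y c →
                   b ⤳ D → c ⤳ D → (∀ d → b ⤳ d → c ⤳ d → D ⤳ d) →
                   (∀ {d} → ¬ Belongs d e) ⊎ (∀ {a} → OnRoutes b c D a → Full a) →
                   ∀ {v a} f → lab v ≡ just a → OnRoutes b c D a →
                   Exit G col (Inside G (λ u → ∃[ d ] lab u ≡ just d × OnRoutes b c D d))
                     (f ∷ []) v D (exitEdge (link D))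
      cycle-full {e} {x} {y} {b} {c} {D} j lx ly gx gy b⤳D c⤳D least hyp {v} {a} f eq on
        with good-or-blocked f eq | hyp
      ... | inj₁ good | _ =
        widen G col (route-inside (λ d → onRoutes-above on)) (climb eq (onRoutes-⤳ on) good)
      ... | inj₂ _ | inj₂ full =
        widen G col (route-inside (λ d → onRoutes-above on))
          (climb eq (onRoutes-⤳ on) (full on f eq))
      ... | inj₂ (refl , inner , p , z , link≡ , same) | inj₁ foreign = around on
        where
        U : Vertex → Set
        U u = ∃[ d ] lab u ≡ just d × OnRoutes b c D d
        e-inside : Inside G U e
        e-inside = inside⁺ G {U = U} j (b , lx , inj₁ (here , b⤳D)) (c , ly , inj₂ (here , c⤳D))
        around : OnRoutes b c D a → Exit G col (Inside G U) (f ∷ []) a D (exitEdge (link D))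
        around (inj₁ (b⤳a , a⤳D)) = enter-like G col same (widen G col
          [ route-inside (λ d q q′ → inj₁ (q , ⤳-trans q′ a⤳D)) ,
            [ (λ { refl → e-inside }) , route-inside (λ d q q′ → inj₂ (q , q′)) ]′ ]′
          (detour j lx ly gx gy foreign b⤳a a⤳D c⤳D least inner link≡))
        -- The same detour with the two ends of `e` exchanged.
        around (inj₂ (c⤳a , a⤳D)) = enter-like G col same (widen G col
          [ route-inside (λ d q q′ → inj₂ (q , ⤳-trans q′ a⤳D)) ,
            [ (λ { refl → e-inside }) , route-inside (λ d q q′ → inj₁ (q , q′)) ]′ ]′
          (detour (Joins-sym G j) ly lx gy gx foreign c⤳a a⤳D b⤳D
            (λ d q q′ → least d q′ q) inner link≡))

      -- Maximality is assumed in terms of frames: none covers more vertices, and none identifies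
      -- two blocks. The `Edge` argument is the dummy edge with which a frame is turned into a
      -- forest.
      module Maximal
          (no-trail : ¬ HasConnectingTrail G col S)
          (no-extension : (B′ : Frame) → Edge →
             (∀ {v b} → lab v ≡ just b → Frame.lab B′ v ≢ nothing) →
             ∀ {y} → lab y ≡ nothing → ¬ (Frame.lab B′ y ≢ nothing))
          (no-merger : (B′ : Frame) → Edge → (μ : Vertex → Vertex) →
             (∀ v → Frame.lab B′ v ≡ Maybe.map μ (lab v)) →
             ∀ {a b} → IsBase a → IsBase b → a ≢ b → ¬ (μ a ≡ μ b)) where

        -- Otherwise `y` could be added as an inner vertex with predecessor edge `e`.
        explored : ∀ {e x y b} → Joins G e x y → lab x ≡ just b → Good lab link e x b →
                   lab y ≢ nothing
        explored {e} j lx gx ly = no-extension Ext.extended e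
          (just≢nothing ∘ Ext.extLab⁺) ly (just≢nothing (Ext.update-here lab _))
          where module Ext = Extend j lx ly gx

        between? : ∀ {b} → IsBase b → ∀ D a → Dec (b ⤳ a × a ⤳ D)
        between? base D a with ⤳? base a
        ... | no ¬p = no (¬p ∘ proj₁)
        ... | yes p = map′ (p ,_) proj₂ (⤳? (⤳-base base p) D)

        -- Merging the blocks on the two routes to `D` would identify the different blocks of `b`
        -- and `c`.
        contractible : ∀ {e x y b c D} → Joins G e x y → lab x ≡ just b → lab y ≡ just c →
                       b ≢ c → Good lab link e x b → Good lab link e y c →
                       b ⤳ D → c ⤳ D → (∀ d → b ⤳ d → c ⤳ d → D ⤳ d) →
                       ¬ ((∀ {d} → ¬ Belongs d e) ⊎ (∀ {a} → OnRoutes b c D a → Full a))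
        contractible {e} {b = b} {c} {D} j lx ly b≢c gx gy p q least hyp =
          no-merger M.merged e M.collapse (λ _ → refl) (lab-base lx) (lab-base ly) b≢c
            (trans (M.collapse-T (inj₁ (here , p))) (sym (M.collapse-T (inj₂ (here , q)))))
          where
          module M = Merge D
            (λ a → between? (lab-base lx) D a ⊎-dec between? (lab-base ly) D a)
            (⤳-base (lab-base lx) p) (inj₁ (p , here)) onRoutes-⤳
            (cycle-full j lx ly gx gy p q least hyp)

        -- Within one tree `e` would close a contractible cycle; between two trees it would complete
        -- a connecting trail.
        good-crossing-is-link : ∀ {e x y b c} → Joins G e x y → lab x ≡ just b → lab y ≡ just c →
                                b ≢ c → Good lab link e x b → Good lab link e y c →
                                ¬ (∀ {d} → ¬ Belongs d e)
        good-crossing-is-link j lx ly b≢c gx gy foreign with meet (lab-base lx) (lab-base ly)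
        ... | inj₁ (_ , p , q , least) = contractible j lx ly b≢c gx gy p q least (inj₁ foreign)
        ... | inj₂ none = no-trail (connecting j lx ly gx gy none)

        -- The routes to the parent `a` pass through the child and the parent only, so if both were
        -- full the forest edge could be contracted.
        arc-¬full : ∀ {b e y a} → Arc b e y a → Full b → ¬ Full a
        arc-¬full {b} {e} {a = a} arc@(base , _ , eq) full-b full-a =
          contractible (joins arc) base eq (λ { refl → arc-⤳̸ arc here refl })
            (full-b e base) (full-a e eq) (up arc here) here (λ _ _ q → q) (inj₂ full)
          where
          full : ∀ {d} → OnRoutes b a a d → Full d
          full {d} (inj₁ (p , q)) with b ≟ d
          ... | yes refl = full-b
          ... | no  b≢d with refl ← ⤳-antisym (⤳-via arc p b≢d) q = full-a
          full (inj₂ (p , q)) with refl ← ⤳-antisym p q = full-a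

        link? : ∀ e → (∃ λ b → ∃₂ λ y a → Arc b e y a) ⊎ (∀ {b y a} → ¬ Arc b e y a)
        link? e with isLink? e
        ... | yes (b , base , y , eq) =
          let a , eq′ = link-target base eq in inj₁ (b , y , a , base , eq , eq′)
        ... | no none = inj₂ λ (base , eq , _) → none (_ , base , _ , eq)

        good-crossing-arc : ∀ {e x y b c} → Joins G e x y → lab x ≡ just b → lab y ≡ just c →
                            b ≢ c → Good lab link e x b → Good lab link e y c →
                            (x ≡ b × Arc b e y c) ⊎ (y ≡ c × Arc c e x b)
        good-crossing-arc {e} j lx ly b≢c gx gy with link? e
        ... | inj₂ none = ⊥-elim (good-crossing-is-link j lx ly b≢c gx gy
                [ crossing-¬within j lx ly b≢c , (λ { (_ , _ , arc) → none arc }) ]′)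
        ... | inj₁ (d , z , a , arc) with Joins-determined G j (joins arc)
        ...   | inj₁ (refl , refl)
                with refl ← same-label lx (proj₁ arc) | refl ← same-label ly (proj₂ (proj₂ arc)) =
                inj₁ (refl , arc)
        ...   | inj₂ (refl , refl)
                with refl ← same-label lx (proj₂ (proj₂ arc)) | refl ← same-label ly (proj₁ arc) =
                inj₂ (refl , arc)

        full-crossing : ∀ {e x y b c} → Joins G e x y → lab x ≡ just b → lab y ≡ just c →
                        b ≢ c → Full b → ¬ Full c
        full-crossing {e} j lx ly b≢c full-b full-c
          with good-crossing-arc j lx ly b≢c (full-b e lx) (full-c e ly)
        ... | inj₁ (_ , arc) = arc-¬full arc full-b full-c
        ... | inj₂ (_ , arc) = arc-¬full arc full-c full-b

  -- The colored blossom forest of a frame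

  quotient-sym : ∀ {I} {π : Partition I} {e i j} → quotient G π e i j → quotient G π e j i
  quotient-sym (i≢j , u , v , u∈ , v∈ , in-I , j) =
    i≢j ∘ sym , v , u , v∈ , u∈ , in-I , Joins-sym G j

  -- An edge e₀ is needed as a dummy entering edge, to read the two trails of
  -- a blossom off  Full.
  module ForestOf (B : Frame) (e₀ : Edge) where
    open Frame B
    open FrameProperties B

    labelled? : ∀ v → Dec (∃[ b ] lab v ≡ just b)
    labelled? v with lab v
    ... | just b  = yes (b , refl)
    ... | nothing = no λ ()

    covered : Subset order
    covered = comprehension labelled?

    bases : Subset order
    bases = comprehension isBase?

    baseAt : Fin ∣ bases ∣ → Vertex
    baseAt = enumerate bases

    baseAt-IsBase : ∀ i → IsBase (baseAt i)
    baseAt-IsBase i = ∈-comprehension⁻ isBase? (enumerate-∈ bases i)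

    indexOf : ∀ {b} → IsBase b → ∃[ i ] baseAt i ≡ b
    indexOf base = enumerate-surjective bases (∈-comprehension⁺ isBase? base)

    baseAt-injective : ∀ {i j} → baseAt i ≡ baseAt j → i ≡ j
    baseAt-injective = enumerate-injective bases

    hasBase? : ∀ i v → Dec (lab v ≡ just (baseAt i))
    hasBase? i v = ≡-dec _≟_ (lab v) (just (baseAt i))

    blockAt : Fin ∣ bases ∣ → Subset order
    blockAt i = comprehension (hasBase? i)

    ∈-blockAt⁺ : ∀ {i v} → lab v ≡ just (baseAt i) → v ∈ blockAt i
    ∈-blockAt⁺ {i} = ∈-comprehension⁺ (hasBase? i)

    ∈-blockAt⁻ : ∀ {i v} → v ∈ blockAt i → lab v ≡ just (baseAt i)
    ∈-blockAt⁻ {i} = ∈-comprehension⁻ (hasBase? i)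

    ∈-covered⁺ : ∀ {v b} → lab v ≡ just b → v ∈ covered
    ∈-covered⁺ eq = ∈-comprehension⁺ labelled? (_ , eq)

    partition : Partition covered
    partition = record
      { #blocks  = ∣ bases ∣
      ; block    = blockAt
      ; nonempty = λ i → baseAt i , ∈-blockAt⁺ (baseAt-IsBase i)
      ; disjoint = λ p q → baseAt-injective (same-label (∈-blockAt⁻ p) (∈-blockAt⁻ q))
      ; union    = λ v → mk⇔ into λ (i , v∈) → ∈-covered⁺ (∈-blockAt⁻ v∈)
      }
      where
      into : ∀ {v} → v ∈ covered → ∃[ i ] v ∈ blockAt i
      into v∈ with ∈-comprehension⁻ labelled? v∈
      ... | b , eq with indexOf (lab-base eq)
      ...   | i , refl = i , ∈-blockAt⁺ eq

    links : Subset size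
    links = comprehension isLink?

    J : Incidence (Fin ∣ bases ∣) Edge
    J e i j = e ∈ links × quotient G partition e i j

    Up : Edge → Fin ∣ bases ∣ → Fin ∣ bases ∣ → Set
    Up e i j = ∃[ y ] Arc (baseAt i) e y (baseAt j)

    rankAt : Fin ∣ bases ∣ → ℕ
    rankAt = rank ∘ baseAt

    J-sym : ∀ {e i j} → J e i j → J e j i
    J-sym (e∈ , q) = e∈ , quotient-sym {π = partition} q

    Up⇒J : ∀ {e i j} → Up e i j → J e i j
    Up⇒J {i = i} (y , arc@(base , eq , eq′)) =
      ∈-comprehension⁺ isLink? (_ , base , y , eq) ,
      (λ { refl → arc-⤳̸ arc here refl }) ,
      baseAt i , y , ∈-blockAt⁺ base , ∈-blockAt⁺ eq′ ,
      inside⁺ G {U = _∈ covered} (joins arc) (∈-covered⁺ base) (∈-covered⁺ eq′) , joins arc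

    direction : ∀ {e i j} → J e i j → Up e i j ⊎ Up e j i
    direction (e∈ , i≢j , u , v , u∈ , v∈ , _ , j) with ∈-comprehension⁻ isLink? e∈
    ... | b , base , y , eq with link-target base eq
    ...   | a , eq′ with crossing-arc j (∈-blockAt⁻ u∈) (∈-blockAt⁻ v∈) (base , eq , eq′)
    ...     | inj₁ (refl , refl) = inj₁ (y , base , eq , eq′)
    ...     | inj₂ (refl , refl) = inj₂ (y , base , eq , eq′)

    Up-functional : ∀ {e f i j k} → Up e i j → Up f i k → e ≡ f × j ≡ k
    Up-functional (_ , arc) (_ , arc′) with arc-functional arc arc′
    ... | e≡f , _ , eq = e≡f , baseAt-injective eq

    Up-rank : ∀ {e i j} → Up e i j → rankAt j < rankAt i
    Up-rank (_ , arc) = arc-rank arc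

    module A = Arborescence {J = J} J-sym Up rankAt direction Up-functional Up-rank

    unlinked? : ∀ i → Dec (link (baseAt i) ≡ nothing)
    unlinked? i with link (baseAt i)
    ... | nothing = yes refl
    ... | just _  = no λ ()

    rootSet : Subset ∣ bases ∣
    rootSet = comprehension unlinked?

    root-¬up : ∀ {r} → r ∈ rootSet → ∀ {e j} → ¬ Up e r j
    root-¬up r∈ (_ , _ , eq , _) = just≢nothing eq (∈-comprehension⁻ unlinked? r∈)

    private
      walkToRoot : ∀ i → Acc _<_ (rankAt i) → ∃[ r ] r ∈ rootSet × Walk J i r
      walkToRoot i (acc rec) with parent (baseAt-IsBase i)
      ... | inj₁ eq = i , ∈-comprehension⁺ unlinked? eq , stay
      ... | inj₂ (e , y , a , arc) with indexOf (lab-base (proj₂ (proj₂ arc)))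
      ...   | j , refl with walkToRoot j (rec (arc-rank arc))
      ...     | r , r∈ , w = r , r∈ , step e (Up⇒J {i = i} {j} (y , arc)) w

    rootedForest : RootedForest (quotient G partition)
    rootedForest = record
      { edgeSet    = links
      ; isEdge     = λ e∈ →
          let b , base , y , eq = ∈-comprehension⁻ isLink? e∈
              a , eq′           = link-target base eq
          in arc-joins (base , eq , eq′)
      ; roots      = rootSet
      ; acyclic    = A.acyclic
      ; hasRoot    = λ i → walkToRoot i (<-wellFounded _)
      ; uniqueRoot = λ r∈ s∈ → A.connected-roots (root-¬up r∈) (root-¬up s∈)
      }
      where
      arc-joins : ∀ {b e y a} → Arc b e y a → ∃₂ λ i j → quotient G partition e i j
      arc-joins arc with indexOf (proj₁ arc) | indexOf (lab-base (proj₂ (proj₂ arc)))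
      ... | i , refl | j , refl = i , j , proj₂ (Up⇒J (_ , arc))

    open RootedForest rootedForest using (Predecessor; PredecessorEdge; Child; hasRoot)

    predecessor-up : ∀ {i e j} → Predecessor i e j → Up e i j
    predecessor-up (r , r∈ , j , w , path) = A.first-step-up {j = j} w path (root-¬up r∈)

    terminalIndex : ∀ {s} → s ∈ S → ∃[ i ] baseAt i ≡ s
    terminalIndex s∈ = indexOf (terminal-base s∈)

    terminalIndex-root : ∀ {s} (s∈ : s ∈ S) → proj₁ (terminalIndex s∈) ∈ rootSet
    terminalIndex-root s∈ = ∈-comprehension⁺ unlinked?
      (trans (cong link (proj₂ (terminalIndex s∈))) (terminal-unlinked s∈))

    root-terminal : ∀ {i} → i ∈ rootSet → baseAt i ∈ S
    root-terminal {i} i∈ =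
      unlinked-terminal (baseAt-IsBase i) (∈-comprehension⁻ unlinked? i∈)

    -- The blocks of the terminals serve as representatives: each root is based at a terminal, and
    -- different roots are not connected.
    components : HasComponents J ∣ S ∣
    components = representative , separate , reach
      where
      terminal : Fin ∣ S ∣ → Vertex
      terminal = enumerate S
      representative : Fin ∣ S ∣ → Fin ∣ bases ∣
      representative k = proj₁ (terminalIndex (enumerate-∈ S k))
      separate : ∀ k l → Walk J (representative k) (representative l) → k ≡ l
      separate k l w = enumerate-injective S (trans
        (sym (proj₂ (terminalIndex (enumerate-∈ S k))))
        (trans (cong baseAt (A.connected-roots (root-¬up (terminalIndex-root (enumerate-∈ S k)))
                                               (root-¬up (terminalIndex-root (enumerate-∈ S l))) w))
               (proj₂ (terminalIndex (enumerate-∈ S l)))))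
      reach : ∀ i → ∃[ k ] Walk J i (representative k)
      reach i with hasRoot i
      ... | r , r∈ , w with enumerate-surjective S (root-terminal r∈)
      ...   | k , eq = k , subst (Walk J i)
                (baseAt-injective (trans (sym eq)
                  (sym (proj₂ (terminalIndex (enumerate-∈ S k)))))) w

    full-of-nonsingleton : ∀ {i u v} → u ∈ blockAt i → v ∈ blockAt i → u ≢ v → Full (baseAt i)
    full-of-nonsingleton {i} u∈ v∈ u≢v with kind (baseAt-IsBase i)
    ... | inj₁ full         = full
    ... | inj₂ (single , _) =
      contradiction (trans (single (∈-blockAt⁻ u∈)) (sym (single (∈-blockAt⁻ v∈)))) u≢v

    into-block : ∀ {i e} → Within (baseAt i) e → Inside G (_∈ blockAt i) e
    into-block (l , r) = ∈-blockAt⁺ l , ∈-blockAt⁺ r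

    rootBlossom : ∀ {s i} → s ∈ S → s ∈ blockAt i → IsBlossom G col (induced G (_∈ blockAt i)) s
    rootBlossom {s} {i} s∈ s∈i with same-label (terminal-base s∈) (∈-blockAt⁻ s∈i)
    ... | refl = record { base = s∈i ; trails = trails }
      where
      trails : ∀ v → v ∈ blockAt i → v ≢ s → _
      trails v v∈ v≢s with two-trails G col e₀ v≢s (λ e → widen G col into-block
        (full-of-nonsingleton v∈ s∈i v≢s e (∈-blockAt⁻ v∈)))
      ... | w , w′ , p , p′ , first , _ = w , w′ , p , p′ , first

    -- Every exit from the block is followed by `e`, so alternation itself forces the last edges to
    -- differ from `e` in color.
    nonRootBlossom : ∀ {i e u} → ∣ blockAt i ∣ ≥ 2 → PredecessorEdge i e → u ∈ blockAt i →
                     (∃[ v ] Joins G e u v) →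
                     IsColorBlossom G col (col e) (induced G (_∈ blockAt i)) u
    nonRootBlossom {i} {e} {u} big (k , pred) u∈ (v , j) with predecessor-up pred
    ... | y , arc@(_ , link≡ , eq) with Joins-determined G j (joins arc)
    -- Here `u` would be the end of the link in the parent block.
    ...   | inj₂ (refl , _) = ⊥-elim (arc-⤳̸ arc here (same-label eq (∈-blockAt⁻ u∈)))
    ...   | inj₁ (refl , _) = record { base = u∈ ; trails = trails ; closedTrail = closed }
      where
      full : Full u
      full with kind (baseAt-IsBase i)
      ... | inj₁ full         = full
      ... | inj₂ (single , _) = ⊥-elim (ℕ.<⇒≱ big (unique⇒∣∣≤1 (blockAt i) λ p q →
        trans (single (∈-blockAt⁻ p)) (sym (single (∈-blockAt⁻ q)))))
      leave : ∀ {v} (f : Edge) → v ∈ blockAt i →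
              Exit G col (Inside G (_∈ blockAt i)) (f ∷ []) v u (e ∷ [])
      leave f v∈ = widen G col into-block (exit-at link≡ (full f (∈-blockAt⁻ v∈)))
      last≢ : ∀ {v} (w : Walk (On G (Inside G (_∈ blockAt i))) v u) → v ≢ u →
              Alt G col (edges w ++ e ∷ []) → ∃[ f ] LastEdge w f × col f ≢ col e
      last≢ stay           v≢u _ = contradiction refl v≢u
      last≢ (step f j w)   _   a = let g , eq = last-∷ f (edges w) in
        g , eq , linked-last (f ∷ edges w) eq a
      trails : ∀ v → v ∈ blockAt i → v ≢ u → _
      trails v v∈ v≢u with two-trails G col e v≢u (λ f → leave f v∈)
      ... | w , w′ , p , p′ , first , a , a′ =
        let f , eq , f≢ = last≢ w v≢u a ; f′ , eq′ , f′≢ = last≢ w′ v≢u a′ in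
        w , w′ , p , p′ , first , f , f′ , eq , eq′ , f≢ , f′≢
      closed : Σ[ w ∈ Walk (JoinsIn (induced G (_∈ blockAt i))) u u ] _
      -- Entering by the predecessor edge itself rules out the empty walk, and alternation with `e`
      -- at both ends gives the two color conditions.
      closed with leave e u∈
      ... | exit stay _ (r ∷ _) = ⊥-elim (r refl)
      ... | exit w@(step f _ w′) t a = let g , eq = last-∷ f (edges w′) in
        w , s≤s z≤n , t , linked-++⁻ˡ (edges w) (Linked.tail a) ,
        f , g , refl , eq , Linked.head a ∘ sym , linked-last (edges w) eq (Linked.tail a)

    innerAlternates : ∀ {i e} → ∣ blockAt i ∣ ≡ 1 → PredecessorEdge i e →
                      ∀ {j f} → Child i j → J f i j → col f ≢ col e
    innerAlternates {i} one (_ , pred) {j} (_ , child) e∈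
      with predecessor-up pred | predecessor-up child | direction e∈
    ... | _ | _ , arc | inj₁ (_ , arc′) = ⊥-elim (arc-⤳̸ arc′ (up arc here) refl)
    ... | _ , _ , link≡ , _ | _ | inj₂ (y , arc) with
          singleton-unique one (∈-blockAt⁺ {i} (proj₂ (proj₂ arc))) (∈-blockAt⁺ (baseAt-IsBase i))
    -- The arc of the child ends at the only vertex of the block. A walk inside the block is empty
    -- there, so alternation compares `f` with `e` directly.
    ...   | refl = alternates (exit-at link≡ (arc-good arc))
      where
      alternates : ∀ {f e v} → Exit G col (Within (baseAt i)) (f ∷ []) v v (e ∷ []) →
                   col f ≢ col e
      alternates (exit stay _ (r ∷ _)) = r
      alternates (exit (step g ((l , r) , _) _) _ _) =
        ⊥-elim (loopless g (singleton-unique one (∈-blockAt⁺ l) (∈-blockAt⁺ r)))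

    forest : ColoredBlossomForest G col S
    forest = record
      { I               = covered
      ; S⊆I             = ∈-covered⁺ ∘ terminal-base
      ; π               = partition
      ; F               = rootedForest
      ; components      = components
      ; rootBlocks      = λ i → mk⇔
          (λ i∈ → baseAt i , root-terminal i∈ , ∈-blockAt⁺ (baseAt-IsBase i))
          (λ (s , s∈ , s∈i) → ∈-comprehension⁺ unlinked?
            (trans (cong link (same-label (∈-blockAt⁻ s∈i) (terminal-base s∈)))
                   (terminal-unlinked s∈)))
      ; rootBlossom     = rootBlossom
      ; innerAlternates = λ _ → innerAlternates
      ; nonRootBlossom  = λ _ → nonRootBlossom
      }

  -- The frame of a colored blossom forest

  module FrameOf (X : ColoredBlossomForest G col S) where
    open ColoredBlossomForest X

    J-sym : ∀ {e i j} → JoinsF e i j → JoinsF e j i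
    J-sym (e∈ , q) = e∈ , quotient-sym {π = π} q

    J-determined : Determined {J = JoinsF}
    J-determined (_ , _ , _ , _ , u∈ , v∈ , _ , j) (_ , _ , _ , _ , u∈′ , v∈′ , _ , j′)
      with Joins-determined G j j′
    ... | inj₁ (refl , refl) = inj₁ (disjoint u∈ u∈′ , disjoint v∈ v∈′)
    ... | inj₂ (refl , refl) = inj₂ (disjoint u∈ v∈′ , disjoint v∈ u∈′)

    -- Both paths start at `i`, so they lead to the same root, and a forest has only one path there.
    predecessorEdge-unique : ∀ {i e f} → PredecessorEdge i e → PredecessorEdge i f → e ≡ f
    predecessorEdge-unique (_ , r , r∈ , j , w , p) (_ , s , s∈ , k , v , q)
      with refl ← uniqueRoot r∈ s∈ (reverseWalk J-sym (step _ j w) ⌢ step _ k v) =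
      unique-first-edge _≟_ _≟_ J-sym J-determined acyclic {j = j} {k = k} w v p q

    RootPath : Fin #blocks → Set
    RootPath i = ∃[ r ] r ∈ roots × Σ[ w ∈ Walk JoinsF i r ] IsPath w

    rootPath : ∀ i → RootPath i
    rootPath i = let r , r∈ , w = hasRoot i in r , r∈ , eraseLoops _≟_ w

    pathLength : ∀ {i} → RootPath i → ℕ
    pathLength (_ , _ , w , _) = length (edges w)

    pathLength-unique : ∀ {i} (p q : RootPath i) → pathLength p ≡ pathLength q
    pathLength-unique (r , r∈ , w , p) (s , s∈ , v , q)
      with refl ← uniqueRoot r∈ s∈ (reverseWalk J-sym w ⌢ v) =
      path-length-unique _≟_ _≟_ J-sym J-determined acyclic w v p q

    depth : Fin #blocks → ℕ
    depth i = pathLength (rootPath i)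

    -- Removing the first edge from a path to the root leaves a root path of the parent that is
    -- shorter by one.
    predecessor-depth : ∀ {i e j} → Predecessor i e j → depth j < depth i
    predecessor-depth {i} {e} {j} (r , r∈ , k , w , p) = subst₂ _<_
      (pathLength-unique (r , r∈ , w , IsPath-tail {e = e} {j = k} w p) (rootPath j))
      (pathLength-unique (r , r∈ , step e k w , p) (rootPath i))
      ℕ.≤-refl

    predecessor-joins : ∀ {i e j} → Predecessor i e j → JoinsF e i j
    predecessor-joins (_ , _ , j , _) = j

    -- The data from which base and link of a block are read off: a terminal for a root, and
    -- otherwise the two ends of the predecessor edge, the inner one being the base.
    data Seat (i : Fin #blocks) : Set where
      root  : ∀ {s} → i ∈ roots → s ∈ S → s ∈ block i → Seat i
      child : ∀ {e j u v} → i ∉ roots → Predecessor i e j →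
              u ∈ block i → v ∈ block j → Joins G e u v → Seat i

    seat : ∀ i → Seat i
    seat i with i ∈? roots
    ... | yes i∈ = let s , s∈ , s∈i = Equivalence.to (rootBlocks i) i∈ in root i∈ s∈ s∈i
    ... | no  i∉ with rootPath i
    ...   | _ , i∈ , stay , _ = contradiction i∈ i∉
    ...   | r , r∈ , step e j@(_ , _ , u , v , u∈ , v∈ , _ , uv) w , p =
      child i∉ (r , r∈ , j , w , p) u∈ v∈ uv

    seatBase : ∀ {i} → Seat i → Vertex
    seatBase (root {s} _ _ _)        = s
    seatBase (child {u = u} _ _ _ _ _) = u

    seatLink : ∀ {i} → Seat i → Maybe (Edge × Vertex)
    seatLink (root _ _ _)                    = nothing
    seatLink (child {e = e} {v = v} _ _ _ _ _) = just (e , v)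

    seatBase-∈ : ∀ {i} (σ : Seat i) → seatBase σ ∈ block i
    seatBase-∈ (root _ _ s∈i)        = s∈i
    seatBase-∈ (child _ _ u∈ _ _) = u∈

    seatLink-target : ∀ {i e y} (σ : Seat i) → seatLink σ ≡ just (e , y) →
                      ∃[ j ] y ∈ block j × Predecessor i e j × Joins G e (seatBase σ) y
    seatLink-target (child _ pred _ v∈ uv) refl = _ , v∈ , pred , uv

    seat-unlinked : ∀ {i} (σ : Seat i) → seatLink σ ≡ nothing → seatBase σ ∈ S
    seat-unlinked (root _ s∈ _) _ = s∈

    seat-nonroot : ∀ {i} (σ : Seat i) → i ∉ roots → ∃₂ λ e y → seatLink σ ≡ just (e , y)
    seat-nonroot (root i∈ _ _)      i∉ = contradiction i∈ i∉
    seat-nonroot (child _ _ _ _ _) _  = _ , _ , refl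

    baseOf : Fin #blocks → Vertex
    baseOf i = seatBase (seat i)

    -- Abstract, so that unification can recover v from labX v.
    abstract
      blockIndex : Vertex → Maybe (Fin #blocks)
      blockIndex v with v ∈? I
      ... | yes v∈ = just (proj₁ (Equivalence.to (union v) v∈))
      ... | no  _  = nothing

      blockIndex⁺ : ∀ {v i} → v ∈ block i → blockIndex v ≡ just i
      blockIndex⁺ {v} {i} v∈i with v ∈? I
      ... | yes v∈ = cong just (disjoint (proj₂ (Equivalence.to (union v) v∈)) v∈i)
      ... | no  v∉ = contradiction (Equivalence.from (union v) (i , v∈i)) v∉

      blockIndex⁻ : ∀ {v i} → blockIndex v ≡ just i → v ∈ block i
      blockIndex⁻ {v} eq with v ∈? I
      blockIndex⁻ {v} refl | yes v∈ = proj₂ (Equivalence.to (union v) v∈)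

    labX : Vertex → Maybe Vertex
    labX v = Maybe.map baseOf (blockIndex v)

    linkX : Vertex → Maybe (Edge × Vertex)
    linkX v = Maybe.maybe′ (λ i → seatLink (seat i)) nothing (blockIndex v)

    rankX : Vertex → ℕ
    rankX v = Maybe.maybe′ depth 0 (blockIndex v)

    labX⁺ : ∀ {v i} → v ∈ block i → labX v ≡ just (baseOf i)
    labX⁺ v∈ = cong (Maybe.map baseOf) (blockIndex⁺ v∈)

    labX⁻ : ∀ {v b} → labX v ≡ just b → ∃[ i ] v ∈ block i × b ≡ baseOf i
    labX⁻ {v} eq with blockIndex v in eq′
    labX⁻ refl | just i = i , blockIndex⁻ eq′ , refl

    baseOf-∈ : ∀ i → baseOf i ∈ block i
    baseOf-∈ i = seatBase-∈ (seat i)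

    baseOf-injective : ∀ {i j} → baseOf i ≡ baseOf j → i ≡ j
    baseOf-injective {i} {j} eq = disjoint (subst (_∈ block i) eq (baseOf-∈ i)) (baseOf-∈ j)

    labX-block : ∀ {v i} → labX v ≡ just (baseOf i) → v ∈ block i
    labX-block {i = i} eq with labX⁻ eq
    ... | j , v∈ , eq′ with refl ← baseOf-injective {i} {j} eq′ = v∈

    linkX-at : ∀ {v i} → v ∈ block i → linkX v ≡ seatLink (seat i)
    linkX-at v∈ = cong (Maybe.maybe′ _ nothing) (blockIndex⁺ v∈)

    rankX-at : ∀ {v i} → v ∈ block i → rankX v ≡ depth i
    rankX-at v∈ = cong (Maybe.maybe′ depth 0) (blockIndex⁺ v∈)

    linkX-target : ∀ {i e y} → linkX (baseOf i) ≡ just (e , y) →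
                   ∃[ j ] y ∈ block j × Predecessor i e j × Joins G e (baseOf i) y
    linkX-target {i} eq = seatLink-target (seat i) (trans (sym (linkX-at (baseOf-∈ i))) eq)

    linkX-nonroot : ∀ {i} → i ∉ roots → ∃₂ λ e y → linkX (baseOf i) ≡ just (e , y)
    linkX-nonroot {i} i∉ = let e , y , eq = seat-nonroot (seat i) i∉ in
      e , y , trans (linkX-at (baseOf-∈ i)) eq

    module _ (no-trail : ¬ HasConnectingTrail G col S)
             (_≟ᶜ_ : (e f : Edge) → Dec (col e ≡ col f)) where

      -- A root block is a blossom based at `t`, so it would contain an alternating trail from `s`
      -- to `t`.
      one-terminal-per-block : ∀ {s t i} → s ∈ S → t ∈ S → s ∈ block i → t ∈ block i → s ≡ t
      one-terminal-per-block {s} {t} s∈ t∈ s∈i t∈i with s ≟ t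
      ... | yes s≡t = s≡t
      ... | no  s≢t with IsBlossom.trails (rootBlossom t∈ t∈i) s s∈i s≢t
      ...   | w , _ , (trail , alt , _) , _ = contradiction
        (s , t , s∈ , t∈ , s≢t , mapWalk proj₂ w ,
         subst Unique (sym (edges-mapWalk proj₂ w)) trail ,
         subst (Alt G col) (sym (edges-mapWalk proj₂ w)) alt , ⊥-elim ∘ s≢t)
        no-trail

      terminal-seat : ∀ {s i} (σ : Seat i) → s ∈ S → s ∈ block i →
                      seatBase σ ≡ s × seatLink σ ≡ nothing
      terminal-seat (root _ t∈ t∈i)    s∈ s∈i = one-terminal-per-block t∈ s∈ t∈i s∈i , refl
      terminal-seat (child i∉ _ _ _ _) s∈ s∈i =
        contradiction (Equivalence.from (rootBlocks _) (_ , s∈ , s∈i)) i∉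

      terminal-block : ∀ {s} → s ∈ S → ∃[ i ] s ∈ block i
      terminal-block s∈ = Equivalence.to (union _) (S⊆I s∈)

      Singleton : Fin #blocks → Set
      Singleton i = ∣ block i ∣ ≡ 1 × i ∉ roots

      Leavable : ∀ {i} → Seat i → Set
      Leavable {i} σ = ∀ {v} e → v ∈ block i →
        Exit G col (Inside G (_∈ block i)) (e ∷ []) v (seatBase σ) (exitEdge (seatLink σ))

      kindOf : ∀ {i} (σ : Seat i) → Leavable σ ⊎ Singleton i
      kindOf {i} (root {s} i∈ s∈ s∈i) = inj₁ leave
        where
        leave : ∀ {v} e → v ∈ block i →
                Exit G col (Inside G (_∈ block i)) (e ∷ []) v s []
        leave {v} e v∈ with v ≟ s
        -- A root block has no exit edge, so at its base the empty walk is enough.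
        ... | yes refl = exit-empty G col [-]
        ... | no  v≢s with IsBlossom.trails (rootBlossom s∈ s∈i) v v∈ v≢s
        ...   | w , w′ , (t , a , _) , (t′ , a′ , _) , first =
          exit-one-of-two G col _≟ᶜ_ w w′ t t′
            (subst (Alt G col) (sym (++-identityʳ _)) a)
            (subst (Alt G col) (sym (++-identityʳ _)) a′) first e
      kindOf {i} (child {e = e} {u = u} i∉ pred u∈ v∈ uv) with ∣ block i ∣ ℕ.≟ 1
      ... | yes one = inj₂ (one , i∉)
      ... | no  ≢1  = inj₁ leave
        where
        blossom = nonRootBlossom i∉
          (ℕ.≤∧≢⇒< (nonempty⇒∣∣≥1 u∈) (≢1 ∘ sym)) (_ , pred) u∈ (_ , uv)
        leave : ∀ {v} f → v ∈ block i →
                Exit G col (Inside G (_∈ block i)) (f ∷ []) v u (e ∷ [])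
        leave {v} f v∈i with v ≟ u
        ... | no v≢u with IsColorBlossom.trails blossom v v∈i v≢u
        ...   | w , w′ , (t , a , _) , (t′ , a′ , _) , first , _ , _ , last , last′ , l≢ , l′≢ =
          exit-one-of-two G col _≟ᶜ_ w w′ t t′
            (linked-snoc last l≢ a) (linked-snoc last′ l′≢ a′) first f
        leave {v} f v∈i | yes refl with f ≟ᶜ e
        ... | no f≢e = exit-empty G col (f≢e ∷ [-])
        -- Arriving at the base with the color of the exit edge, the walk first goes around the
        -- closed trail.
        ... | yes same with IsColorBlossom.closedTrail blossom
        ...   | w , _ , t , a , _ , _ , first , last , f≢ , l≢ = exit w t
          (linked-cons (head-++ first) (λ eq → f≢ (trans (sym eq) same)) (linked-snoc last l≢ a))

      leavable-full : ∀ {i v} → Leavable (seat i) → ∀ e → labX v ≡ just (baseOf i) →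
                      Good labX linkX e v (baseOf i)
      leavable-full {i} {v} leave e eq = exit-at (sym (linkX-at (baseOf-∈ i)))
        (widen G col (λ { (l , r) → labX⁺ l , labX⁺ r }) (leave e (labX-block {v} eq)))

      singleton-base : ∀ {i v} → Singleton i → v ∈ block i → v ≡ baseOf i
      singleton-base {i} (one , _) v∈ = singleton-unique one v∈ (baseOf-∈ i)

      good-singleton : ∀ {i v e} → Singleton i → v ∈ block i →
                       (∀ {f} → PredecessorEdge i f → col e ≢ col f) →
                       Good labX linkX e v (baseOf i)
      good-singleton {i} {v} {e} single v∈ differ =
        subst (λ u → Good labX linkX e u (baseOf i)) (sym (singleton-base single v∈))
          (exit-empty G col (alt (linkX-nonroot (proj₂ single))))
        where
        alt : (∃₂ λ f y → linkX (baseOf i) ≡ just (f , y)) →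
              Alt G col (e ∷ exitEdge (linkX (baseOf i)))
        alt (f , y , eq) with linkX-target {i} eq
        ... | _ , _ , pred , _ =
          subst (λ m → Alt G col (e ∷ exitEdge m)) (sym eq) (differ (_ , pred) ∷ [-])

      frame : Frame
      frame = record
        { lab               = labX
        ; link              = linkX
        ; rank              = rankX
        ; lab-base          = λ eq → base (labX⁻ eq)
        ; terminal-base     = λ s∈ → let i , s∈i = terminal-block s∈ in
            trans (labX⁺ s∈i) (cong just (proj₁ (terminal-seat (seat i) s∈ s∈i)))
        ; terminal-unlinked = λ s∈ → let i , s∈i = terminal-block s∈ in
            trans (linkX-at s∈i) (proj₂ (terminal-seat (seat i) s∈ s∈i))
        ; unlinked-terminal = λ b eq → unlinked (labX⁻ b) eq
        ; link-joins        = λ b eq → link-joins (labX⁻ b) eq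
        ; link-target       = λ b eq → link-target (labX⁻ b) eq
        ; arc-rank          = λ { (b , eq , l) → arc-rank (labX⁻ b) eq l }
        ; arc-good          = λ { (b , eq , l) → arc-good (labX⁻ b) eq l }
        ; kind              = λ b → kind (labX⁻ b)
        }
        where
        At : Vertex → Vertex → Set
        At v b = ∃[ i ] v ∈ block i × b ≡ baseOf i

        base : ∀ {v b} → At v b → labX b ≡ just b
        base (i , _ , refl) = labX⁺ (baseOf-∈ i)

        unlinked : ∀ {b} → At b b → linkX b ≡ nothing → b ∈ S
        unlinked (i , b∈ , refl) eq = seat-unlinked (seat i) (trans (sym (linkX-at b∈)) eq)

        link-joins : ∀ {b e y} → At b b → linkX b ≡ just (e , y) → Joins G e b y
        link-joins (i , _ , refl) eq = let _ , _ , _ , j = linkX-target {i} eq in j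

        link-target : ∀ {b e y} → At b b → linkX b ≡ just (e , y) → ∃[ a ] labX y ≡ just a
        link-target (i , _ , refl) eq = let j , y∈ , _ = linkX-target {i} eq in _ , labX⁺ y∈

        arc-rank : ∀ {b e y a} → At b b → linkX b ≡ just (e , y) → labX y ≡ just a →
                   rankX a < rankX b
        arc-rank (i , b∈ , refl) eq l with linkX-target {i} eq
        ... | j , y∈ , pred , _ with refl ← just-injective (trans (sym l) (labX⁺ y∈)) =
          subst₂ _<_ (sym (rankX-at (baseOf-∈ j))) (sym (rankX-at b∈)) (predecessor-depth pred)

        arc-good : ∀ {b e y a} → At b b → linkX b ≡ just (e , y) → labX y ≡ just a →
                   Good labX linkX e y a
        arc-good {e = e} (i , b∈ , refl) eq l with linkX-target {i} eq
        ... | j , y∈ , pred , _ with refl ← just-injective (trans (sym l) (labX⁺ y∈))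
            with kindOf (seat j)
        ...   | inj₁ leave = leavable-full leave _ l
        -- The arriving edge comes from a child of `j`, and an inner vertex has child edges of other
        -- colors than its predecessor edge.
        ...   | inj₂ single@(one , j∉) = good-singleton single y∈ λ pred′ →
                  innerAlternates j∉ one pred′ (_ , pred) (J-sym (predecessor-joins pred))

        kind : ∀ {b} → At b b →
               (∀ {v} e → labX v ≡ just b → Good labX linkX e v b) ⊎
               ((∀ {v} → labX v ≡ just b → v ≡ b) × linkX b ≢ nothing)
        kind (i , _ , refl) with kindOf (seat i)
        ... | inj₁ leave = inj₁ (leavable-full leave)
        ... | inj₂ single = inj₂
          ((λ {v} eq → singleton-base single (labX-block {v} eq)) ,
           let _ , _ , eq = linkX-nonroot (proj₂ single) in just≢nothing eq)

      -- Maximality of the forest, and the conditions on a Tutte set.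

      module _ (maximal : IsMaximal G col S X) where
        open Frame frame using (Arc; Full; IsBase; lab-base)
        open FrameProperties frame using (same-label)

        private
          labelled : ∀ {m : Maybe Vertex} → m ≢ nothing → ∃[ b ] m ≡ just b
          labelled {just b}  _ = b , refl
          labelled {nothing} n = contradiction refl n

        ∈I⇒labelled : ∀ {v} → v ∈ I → ∃[ i ] labX v ≡ just (baseOf i)
        ∈I⇒labelled v∈ = let i , v∈i = Equivalence.to (union _) v∈ in i , labX⁺ v∈i

        labelled⇒∈I : ∀ {v b} → labX v ≡ just b → v ∈ I
        labelled⇒∈I {v} eq = let i , v∈ , _ = labX⁻ {v} eq in Equivalence.from (union v) (i , v∈)

        no-extension : (B′ : Frame) → Edge →
                       (∀ {v b} → labX v ≡ just b → Frame.lab B′ v ≢ nothing) →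
                       ∀ {y} → labX y ≡ nothing → ¬ (Frame.lab B′ y ≢ nothing)
        no-extension B′ e₀ keeps {y} ly new = maximal forest (inj₁
          ((λ v∈ → ∈-covered⁺ (proj₂ (labelled (keeps (proj₂ (∈I⇒labelled v∈)))))) ,
           y , ∈-covered⁺ (proj₂ (labelled new)) ,
           λ y∈ → just≢nothing (proj₂ (∈I⇒labelled y∈)) ly))
          where open ForestOf B′ e₀

        -- The covered set stays the same. If the partition did too, the block that now contains
        -- both `a` and `b` would be an old block with two bases.
        no-merger : (B′ : Frame) → Edge → (μ : Vertex → Vertex) →
                    (∀ v → Frame.lab B′ v ≡ Maybe.map μ (labX v)) →
                    ∀ {a b} → IsBase a → IsBase b → a ≢ b → ¬ (μ a ≡ μ b)
        no-merger B′ e₀ μ lab≡ {a} {b} base-a base-b a≢b μ≡ =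
          maximal forest (inj₂ (⊆-antisym I⊆ ⊆I , coarser , different))
          where
          open ForestOf B′ e₀
          push : ∀ {v c} → labX v ≡ just c → Frame.lab B′ v ≡ just (μ c)
          push {v} eq = trans (lab≡ v) (cong (Maybe.map μ) eq)
          I⊆ : I ⊆ covered
          I⊆ v∈ = ∈-covered⁺ (push (proj₂ (∈I⇒labelled v∈)))
          pull : ∀ {v c} → Frame.lab B′ v ≡ just c → ∃[ d ] labX v ≡ just d
          pull {v} eq with labX v | lab≡ v
          ... | just d  | _   = d , refl
          ... | nothing | eq′ = contradiction eq′ (just≢nothing eq)
          ⊆I : covered ⊆ I
          ⊆I {v} v∈ = labelled⇒∈I {v} (proj₂ (pull (proj₂ (∈-comprehension⁻ labelled? v∈))))
          newIndex : ∀ i → ∃[ j ] baseAt j ≡ μ (baseOf i)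
          newIndex i = indexOf (Frame.lab-base B′ (push (labX⁺ (baseOf-∈ i))))
          coarser : π ≤π partition
          coarser i with newIndex i
          ... | j , eq = j , λ v∈ →
            ∈-blockAt⁺ (trans (push (labX⁺ v∈)) (cong just (sym eq)))
          different : ¬ (π ≈π partition)
          different (_ , back) with indexOf (Frame.lab-base B′ (push base-a))
          ... | j , eq with back j
          ...   | i , same = a≢b (trans (in-i base-a refl) (sym (in-i base-b μ≡)))
            where
            in-i : ∀ {c} → IsBase c → μ a ≡ μ c → c ≡ baseOf i
            in-i {c} base-c μ≡′ = same-label {v = c} base-c (labX⁺ (subst (c ∈_) (sym same)
              (∈-blockAt⁺ (trans (push base-c) (cong just (sym (trans eq μ≡′)))))))

        open FrameProperties.Maximal frame _≟ᶜ_ no-trail no-extension no-merger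

        Mismatch : Edge → Set
        Mismatch = Mismatched G col S IsInner IsInnerOfColor

        InComponent : Vertex → Pred Vertex 0ℓ
        InComponent = Component G col S IsInner IsInnerOfColor

        Touches : Edge → Pred Vertex 0ℓ → Set
        Touches e H = HasEndpointIn G col S IsInner IsInnerOfColor H e

        outer-full : ∀ {v b} → ¬ IsInner v → labX v ≡ just b → Full b
        outer-full {v} outer eq with labX⁻ {v} eq
        ... | i , v∈ , refl with kindOf (seat i)
        ...   | inj₁ leave       = leavable-full leave
        ...   | inj₂ (one , i∉)  = contradiction (i , v∈ , one , i∉) outer

        inner-label : ∀ {v} → IsInner v → labX v ≡ just v
        inner-label (i , v∈ , single) =
          trans (labX⁺ v∈) (cong just (sym (singleton-base single v∈)))

        inner-alone : ∀ {u v} → IsInner u → labX v ≡ just u → v ≡ u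
        inner-alone {u} {v} (i , u∈ , single) eq with labX⁻ {v} eq
        ... | j , v∈ , refl with refl ← disjoint (baseOf-∈ j) u∈ = singleton-base single v∈

        color-link : ∀ {c u e y} → IsInnerOfColor c u → linkX u ≡ just (e , y) → col e ≡ c
        color-link {u = u} ((i , u∈ , single) , j , f , u∈j , pred , refl) eq
          with refl ← disjoint u∈j u∈
          with linkX-target {j} (trans (cong linkX (sym (singleton-base single u∈))) eq)
        ... | _ , _ , pred′ , _ = cong col (predecessorEdge-unique (_ , pred′) pred)

        color-good : ∀ {c u f} → IsInnerOfColor c u → col f ≢ c → Good labX linkX f u u
        color-good {c} {u} {f} inner@((i , u∈ , single) , j , g , u∈j , pred , eq) f≢c =
          subst (λ b → Good labX linkX f u b) (sym (singleton-base single u∈))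
            (good-singleton single u∈ λ pred′ → f≢c ∘ λ same →
              trans same (trans (cong col (predecessorEdge-unique pred′
                (subst (λ k → PredecessorEdge k g) (disjoint u∈j u∈) pred))) eq))

        -- The edge is good at `u` because of its color, and at `v` because the block of `v` is
        -- full. So it is a predecessor edge, and not that of `u`, whose color is `c`.
        mismatch-arc : ∀ {e u v c} → Joins G e u v → IsInnerOfColor c u → ¬ IsInner v → col e ≢ c →
                       ∃[ y ] Arc v e y u
        mismatch-arc {e} {u} {v} j inner outer e≢c
          with labelled (explored j (inner-label (proj₁ inner)) (color-good inner e≢c))
        ... | b , lv
          with good-crossing-arc j (inner-label (proj₁ inner)) lv
                 -- If the labels agreed, `v` would be the inner vertex `u`, and `e` a loop.
                 (λ { refl → Joins-irreflexive G
                        (subst (Joins G e u) (inner-alone (proj₁ inner) lv) j) })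
                 (color-good inner e≢c) (outer-full outer lv e lv)
        ... | inj₁ (_ , _ , eq , _) = contradiction (color-link inner eq) e≢c
        ... | inj₂ (refl , arc)     = u , arc

        endpoint-arc : ∀ {e u v} → Mismatch e → Joins G e u v →
                       ¬ IsInner u → ∃₂ λ y a → Arc u e y a
        endpoint-arc (inj₁ (_ , _ , _ , j′ , A-u′ , outer′ , color , e≢c)) j outer
          with Joins-determined G j j′
        ... | inj₁ (refl , _) = contradiction A-u′ outer
        ... | inj₂ (refl , _) = let y , arc = mismatch-arc j′ color outer′ e≢c in y , _ , arc
        endpoint-arc (inj₂ (_ , _ , _ , _ , j′ , A-u′ , A-v′ , _)) j outer
          with Joins-determined G j j′
        ... | inj₁ (refl , _) = contradiction A-u′ outer
        ... | inj₂ (refl , _) = contradiction A-v′ outer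

        -- A covered end outside `A` lies in a full block: an uncovered neighbour would contradict
        -- `explored`, and one in another full block `full-crossing`.
        outer-step : ∀ {e u v} → Joins G e u v → ¬ IsInner u → ¬ IsInner v → labX u ≡ labX v
        outer-step {e} {u} {v} j out-u out-v with labX u in eq | labX v in eq′
        ... | nothing | nothing = refl
        ... | just a | nothing  =
          contradiction eq′ (explored j eq (outer-full {u} out-u eq e eq))
        ... | nothing | just b  =
          contradiction eq (explored (Joins-sym G j) eq′ (outer-full {v} out-v eq′ e eq′))
        ... | just a | just b with a ≟ b
        ...   | yes refl = refl
        ...   | no  a≢b  =
          ⊥-elim (full-crossing j eq eq′ a≢b (outer-full {u} out-u eq) (outer-full {v} out-v eq′))

        -- A component of G - A therefore lies in a single block or is entirely uncovered.
        component-label : ∀ {h u} → ¬ IsInner h → InComponent h u →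
                          ¬ IsInner u × labX h ≡ labX u
        component-label out stay = out , refl
        component-label out (step e (avoids-A , j) w)
          with inside⁻ G {U = ¬_ ∘ IsInner} avoids-A j
        ... | _ , out′ with component-label out′ w
        ...   | out″ , eq = out″ , trans (outer-step j out out′) eq

        LinkedAt : Vertex → Edge → Set
        LinkedAt h e = ∃[ u ] labX h ≡ just u × (∃[ y ] linkX u ≡ just (e , y))

        endpoint-in-component : ∀ {h e} → ¬ IsInner h → Mismatch e →
                                Touches e (InComponent h) → LinkedAt h e
        endpoint-in-component out mis (u , v , j , w) with component-label out w
        ... | out-u , eq with endpoint-arc mis j out-u
        ...   | y , _ , base , link≡ , _ = u , trans eq base , y , link≡

        linkedAt-unique : ∀ {h e f} → LinkedAt h e → LinkedAt h f → e ≡ f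
        linkedAt-unique (u , eq , y , link≡) (u′ , eq′ , y′ , link≡′) = cong proj₁
          (just-injective (trans (sym link≡)
            (trans (cong linkX (just-injective (trans (sym eq) eq′))) link≡′)))

        linkedAt-nonterminal : ∀ {h s e} → s ∈ S → labX h ≡ labX s → ¬ LinkedAt h e
        linkedAt-nonterminal s∈ same (u , eq , y , link≡) = just≢nothing link≡
          (trans (cong linkX (just-injective
            (trans (sym eq) (trans same (Frame.terminal-base frame s∈)))))
            (Frame.terminal-unlinked frame s∈))

        -- Differing from both colors, the edge would be good at both inner ends, hence the
        -- predecessor edge of one of them and of its color.
        inner-edge-matched : ∀ {e u v} → Mismatch e → Joins G e u v →
                             ¬ (IsInner u × IsInner v)
        inner-edge-matched (inj₁ (_ , _ , _ , j′ , _ , outer , _)) j (A-u , A-v)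
          with Joins-determined G j j′
        ... | inj₁ (refl , refl) = outer A-v
        ... | inj₂ (refl , refl) = outer A-u
        inner-edge-matched (inj₂ (u , v , c , d , j , A-u , A-v , color , color′ , e≢c , e≢d)) _ _
          with good-crossing-arc j (inner-label A-u) (inner-label A-v)
                 (λ { refl → Joins-irreflexive G j })
                 (color-good color e≢c) (color-good color′ e≢d)
        ... | inj₁ (_ , _ , eq , _) = e≢c (color-link color eq)
        ... | inj₂ (_ , _ , eq , _) = e≢d (color-link color′ eq)

        -- All vertices of the component have the same label, and a terminal is its own label.
        one-terminal : ∀ {h s t} → ¬ IsInner h → s ∈ S → t ∈ S →
                       InComponent h s →
                       InComponent h t → s ≡ t
        one-terminal out s∈ t∈ w w′ = just-injective (trans
          (sym (Frame.terminal-base frame s∈))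
          (trans (sym (proj₂ (component-label out w)))
            (trans (proj₂ (component-label out w′)) (Frame.terminal-base frame t∈))))

        terminal-component-matched :
          ∀ {h s e} → ¬ IsInner h → s ∈ S → InComponent h s →
          Mismatch e →
          ¬ Touches e (InComponent h)
        terminal-component-matched out s∈ w mis end =
          linkedAt-nonterminal s∈ (proj₂ (component-label out w))
            (endpoint-in-component out mis end)

        one-mismatch :
          ∀ {h e f} → ¬ IsInner h →
          Mismatch e → Mismatch f →
          Touches e (InComponent h) →
          Touches f (InComponent h) → e ≡ f
        one-mismatch out mis mis′ end end′ =
          linkedAt-unique (endpoint-in-component out mis end) (endpoint-in-component out mis′ end′)

-- Double negation over finitely many edges, and the theorem.

¬¬-∀ : ∀ {n} {P : Fin n → Set} → (∀ i → ¬ ¬ P i) → ¬ ¬ (∀ i → P i)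
¬¬-∀ {zero}  _ k = k λ ()
¬¬-∀ {suc n} p k = p zero λ p₀ → ¬¬-∀ (p ∘ suc) λ pₛ → k λ { zero → p₀ ; (suc i) → pₛ i }

theorem2p10 : {C : Set} → (∃₂ λ (c d : C) → c ≢ d) →
    (G : Graph) (col : Graph.Edge G → C) (S : Subset (Graph.order G)) →
    ¬ HasConnectingTrail G col S →
    (X : ColoredBlossomForest G col S) → IsMaximal G col S X →
    IsTutteSet G col S (ColoredBlossomForest.IsInner X) (ColoredBlossomForest.IsInnerOfColor X)
theorem2p10 _ G col S no-trail X maximal = record
  { avoidsTerminals  = λ { (i , v∈ , _ , i∉) v∈S →
      i∉ (Equivalence.from (rootBlocks i) (_ , v∈S , v∈)) }
  ; colorUnion       = λ v → mk⇔
      (λ { inner@(i , v∈ , _ , i∉) → let e , pred = nonroot-edge (seat i) i∉ in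
           col e , inner , i , e , v∈ , pred , refl })
      (proj₁ ∘ proj₂)
  ; colorDisjoint    = λ
      { (_ , i , e , v∈ , pred , refl) (_ , j , f , v∈′ , pred′ , refl) →
        cong col (predecessorEdge-unique pred
          (subst (λ k → PredecessorEdge k f) (disjoint v∈′ v∈) pred′)) }
  ; oneTerminal      = λ h out s∈ t∈ w w′ → decidable-stable (_ ≟ _) λ s≢t →
      decidable λ dec → s≢t (one-terminal no-trail dec maximal out s∈ t∈ w w′)
  ; terminalComp     = λ { h out (s , s∈ , w) e mis end →
      decidable λ dec → terminal-component-matched no-trail dec maximal out s∈ w mis end }
  ; terminalFreeComp = λ h out _ mis mis′ end end′ → decidable-stable (_ ≟ _) λ e≢f →
      decidable λ dec → e≢f (one-mismatch no-trail dec maximal out mis mis′ end end′)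
  ; insideA          = λ mis j inner →
      decidable λ dec → inner-edge-matched no-trail dec maximal mis j inner
  }
  where
  open ColoredBlossomForest X
  open FrameOf G col S X

  -- C need not have decidable equality, but every remaining claim is stable
  -- under double negation.
  decidable : ¬ ¬ ((e f : Graph.Edge G) → Dec (col e ≡ col f))
  decidable = ¬¬-∀ λ e → ¬¬-∀ λ f → ¬¬-excluded-middle

  nonroot-edge : ∀ {i} → Seat i → i ∉ roots → ∃[ e ] PredecessorEdge i e
  nonroot-edge (root i∈ _ _)         i∉ = contradiction i∈ i∉
  nonroot-edge (child _ pred _ _ _) _  = _ , _ , pred
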